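{- Let $a,b\geq 2$ be integers, $n=a+b-2$, $V=\{1,\dots,n\}$, and consider the 2-connected $(a,b)$-puzzle given by the cycles $\alpha=(1\ 2\ \dots\ a)$ and $\beta=(a-1\ a\ a+1\ \dots\ n)$. The configuration group generated by $\alpha$ and $\beta$ is: (1) isomorphic to $S_{n-1}=S_5$ if $a=b=4$; (2) the alternating group $A_n$ if both $a$ and $b$ are odd; (3) the symmetric group $S_n$ otherwise. Moreover, every permutation in the configuration group can be generated in $O(n^2)$ shifts.
   Context: A shift along a cycle $\gamma$ means composing the current permutation with $\gamma$ or $\gamma^{ -1}$. The configuration group is the subgroup of $S_n$ generated by the given cycles. "A permutation can be generated in $N$ shifts" means it is a product of at most $N$ factors, each one of the given cycles or its inverse; the $O(\cdot)$ bound is uniform in $a,b$ and in the permutation. -}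

module Defs where

open import Data.Nat using (ℕ; zero; suc; _+_; _*_; _∸_; _≤_; _<_; _<?_; _≤?_; _≟_)
open import Data.Nat.DivMod using (_%_)
open import Data.Fin using (Fin; toℕ; fromℕ<)
open import Data.List using (List; []; _∷_; length; map; allFin)
open import Data.Nat.ListAction using (sum)
open import Data.Product using (Σ; ∃; _×_; _,_)
open import Data.Bool using (if_then_else_)
open import Relation.Nullary.Decidable using (yes; no; ⌊_⌋)
open import Relation.Binary.PropositionalEquality using (_≡_)
open import Function using (_∘_; id)
open import Function.Definitions using (Bijective)

-- Vertices 1..n of the paper are encoded as Fin n = {0,...,n-1} (vertex v ↦ v-1).

nV : ℕ → ℕ → ℕ
nV a b = a + b ∸ 2

cycUp : ℕ → ℕ → ℕ → ℕ
cycUp lo hi i with lo ≤? i | i <? hi | i ≟ hi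
... | yes _ | yes _ | _     = suc i
... | yes _ | no _  | yes _ = lo
... | _     | _     | _     = i

cycDown : ℕ → ℕ → ℕ → ℕ
cycDown lo hi i with lo <? i | i ≤? hi | i ≟ lo
... | yes _ | yes _ | _     = i ∸ 1
... | no _  | _     | yes _ = hi
... | _     | _     | _     = i

-- restrict a function on ℕ to Fin n (the fallback branch is never used
-- for the cycles below, whose supports lie inside {0,...,n-1})
liftFin : ∀ {n} → (ℕ → ℕ) → Fin n → Fin n
liftFin {n} f i with f (toℕ i) <? n
... | yes p = fromℕ< p
... | no _  = i

data Gen : Set where
  α α⁻¹ β β⁻¹ : Gen

-- α = (1 2 ... a)      ~ interval [0, a-1] in Fin n
-- β = (a-1 a ... n)    ~ interval [a-2, n-1] in Fin n
gen : (a b : ℕ) → Gen → Fin (nV a b) → Fin (nV a b)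
gen a b α   = liftFin (cycUp 0 (a ∸ 1))
gen a b α⁻¹ = liftFin (cycDown 0 (a ∸ 1))
gen a b β   = liftFin (cycUp (a ∸ 2) (nV a b ∸ 1))
gen a b β⁻¹ = liftFin (cycDown (a ∸ 2) (nV a b ∸ 1))

eval : (a b : ℕ) → List Gen → Fin (nV a b) → Fin (nV a b)
eval a b []      = id
eval a b (g ∷ w) = eval a b w ∘ gen a b g

_≗_ : ∀ {n m} → (Fin n → Fin m) → (Fin n → Fin m) → Set
f ≗ g = ∀ i → f i ≡ g i

GeneratedIn : (a b : ℕ) → ℕ → (Fin (nV a b) → Fin (nV a b)) → Set
GeneratedIn a b N p = Σ (List Gen) λ w → length w ≤ N × eval a b w ≗ p

-- the configuration group <α, β> (as a subset of maps Fin n → Fin n; since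
-- S_n is finite, the generated subgroup is the set of finite words in α^±1, β^±1)
InConfig : (a b : ℕ) → (Fin (nV a b) → Fin (nV a b)) → Set
InConfig a b p = Σ (List Gen) λ w → eval a b w ≗ p

IsPerm : ∀ {m} → (Fin m → Fin m) → Set
IsPerm p = Bijective _≡_ _≡_ p

inversions : ∀ {m} → (Fin m → Fin m) → ℕ
inversions {m} p = sum (map (λ i → sum (map (λ j →
  if ⌊ toℕ i <? toℕ j ⌋ then (if ⌊ toℕ (p j) <? toℕ (p i) ⌋ then 1 else 0) else 0)
  (allFin m))) (allFin m))

IsEven : ∀ {m} → (Fin m → Fin m) → Set
IsEven p = inversions p % 2 ≡ 0

-- a subgroup G (given as a predicate on maps Fin m → Fin m, closed under composition)
-- is isomorphic to S_k: a well-defined, multiplicative bijection G → S_k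
IsoSym : ∀ {m} → ((Fin m → Fin m) → Set) → ℕ → Set
IsoSym {m} G k = Σ ((Fin m → Fin m) → (Fin k → Fin k)) λ φ →
    (∀ g → G g → IsPerm (φ g))
  × (∀ g h → G g → G h → g ≗ h → φ g ≗ φ h)
  × (∀ g h → G g → G h → φ (g ∘ h) ≗ (φ g ∘ φ h))
  × (∀ g h → G g → G h → φ g ≗ φ h → g ≗ h)
  × (∀ σ → IsPerm σ → Σ (Fin m → Fin m) λ g → G g × φ g ≗ σ)

Odd : ℕ → Set
Odd a = a % 2 ≡ 1

-- Let s, t be the two points shared by the cycles and write α = (s t A₁ … A_p), β = (s t B₁ … B_q).
-- The commutator of α and β is (A₁ B₁)(s t). If p ≥ 3, conjugating it by α² and by β⁻¹α² gives
-- (A₃ B₁)(A₁ A₂) and (A₃ t)(A₁ A₂), whose product is a three-cycle; q ≥ 3 is symmetric. If p or q is 1,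
-- one of the generators is a three-cycle; if it is 0, one is a transposition, whose product with a
-- conjugate is a three-cycle. Only p = q = 2 (and the trivial p = q = 0) remains.
--
-- Any point is moved to t by O(n) shifts, and α⁻¹β rotates all points except t, so any ordered pair is
-- moved to any other by O(n) shifts. Conjugating the three-cycle yields, for all x ≠ y, some (x y z) in
-- O(n) shifts, and bounded products of these give every three-cycle in O(n) shifts. A permutation is a
-- product of at most n transpositions, and a pair of transpositions is a product of at most two
-- three-cycles, so every even permutation takes O(n²) shifts; an odd generator, if any, gives the rest.
--
-- For a = b = 4 the six points carry a 1-factorisation of K₆ that both cycles preserve. The action on its
-- five colours is faithful and is all of S₅.

module Submission where

open import Defs
open import Data.Bool using (if_then_else_)
open import Data.Empty using (⊥-elim)
open import Data.Fin using (Fin; zero; suc; toℕ; fromℕ<; inject₁)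
open import Data.Fin.Patterns
open import Data.Fin.Permutation using (Permutation′; permutation; _⟨$⟩ʳ_; _⟨$⟩ˡ_; inverseˡ; remove; _∘ₚ_)
  renaming (transpose to transposeₚ)
open import Data.Fin.Permutation.Components using (transpose; transpose-inverse)
import Data.Fin.Permutation.Transposition.List as TL
open import Data.Fin.Properties using (all?; any?; toℕ-injective; toℕ<n; toℕ-fromℕ<; toℕ-inject₁)
  renaming (_≟_ to _≟F_; suc-injective to sucF-injective)
open import Data.List using (List; []; _∷_; _++_; length; map; allFin; replicate)
open import Data.List.Properties using (map-tabulate; map-cong; length-++; length-map; length-replicate)
open import Data.List.Relation.Unary.All using (All; []; _∷_)
open import Data.Nat using (ℕ; zero; suc; _+_; _*_; _∸_; _^_; _≤_; _<_; _<ᵇ_; _<?_; _≤?_; _≟_; z≤n; s≤s; z<s; s<s; parity)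
open import Data.Nat.DivMod using (_%_)
open import Data.Nat.ListAction using (sum)
open import Data.Nat.Properties
open import Data.Nat.Tactic.RingSolver using (solve-∀)
open import Data.Parity.Base using (Parity; 0ℙ; 1ℙ; _⁻¹) renaming (_+_ to _+ℙ_)
open import Data.Parity.Properties using (⁻¹-involutive; suc-homo-⁻¹; +-homo-+)
open import Data.Product using (Σ; ∃; ∃₂; _×_; _,_; proj₁; proj₂)
open import Data.Sum using (_⊎_; inj₁; inj₂)
open import Data.Vec using (Vec; []; _∷_; lookup)
open import Data.Vec.Relation.Unary.All using ([]; _∷_)
open import Data.Vec.Relation.Unary.AllPairs using ([]; _∷_)
open import Data.Vec.Relation.Unary.Unique.Propositional using (Unique)
open import Data.Vec.Relation.Unary.Unique.Propositional.Properties using (lookup-injective)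
open import Function using (_∘_; id)
open import Function.Bundles using (_⇔_; mk⇔)
open import Function.Definitions using (Injective)
open import Relation.Binary.Definitions using (tri<; tri≈; tri>)
open import Relation.Binary.PropositionalEquality using (_≡_; _≢_; refl; sym; trans; cong; cong₂; subst; ≢-sym; module ≡-Reasoning)
open import Relation.Nullary using (¬_; Dec; yes; no)
open import Relation.Nullary.Decidable using (⌊_⌋; isYes≗does; dec-true; dec-false; True; toWitness; _⊎-dec_; _×-dec_; ¬?)

-- Transpositions and their conjugates

Inj : {m n : ℕ} → (Fin m → Fin n) → Set
Inj f = Injective _≡_ _≡_ f

transpose-fst : {n : ℕ} (x y : Fin n) → transpose x y x ≡ y
transpose-fst x y rewrite dec-true (x ≟F x) refl = refl

transpose-other : {n : ℕ} {x y k : Fin n} → k ≢ x → k ≢ y → transpose x y k ≡ k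
transpose-other {x = x} {y} {k} k≢x k≢y
  rewrite dec-false (k ≟F x) k≢x | dec-false (k ≟F y) k≢y = refl

transpose-snd : {n : ℕ} (x y : Fin n) → transpose x y y ≡ x
transpose-snd x y with y ≟F x
... | yes y≡x = y≡x
... | no _ rewrite dec-true (y ≟F y) refl = refl

transpose-comm : {n : ℕ} (x y : Fin n) → transpose x y ≗ transpose y x
transpose-comm x y k = go (k ≟F x) (k ≟F y)
  where
  go : Dec (k ≡ x) → Dec (k ≡ y) → transpose x y k ≡ transpose y x k
  go (yes refl) _ = trans (transpose-fst x y) (sym (transpose-snd y x))
  go _ (yes refl) = trans (transpose-snd x y) (sym (transpose-fst y x))
  go (no k≢x) (no k≢y) = trans (transpose-other k≢x k≢y) (sym (transpose-other k≢y k≢x))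

transpose-self : {n : ℕ} (x : Fin n) → transpose x x ≗ id
transpose-self x k with k ≟F x
... | yes refl = refl
... | no k≢x rewrite dec-false (k ≟F x) k≢x = refl

transpose-involutive : {n : ℕ} (x y : Fin n) → (transpose x y ∘ transpose x y) ≗ id
transpose-involutive x y k = trans (cong (transpose x y) (transpose-comm x y k)) (transpose-inverse x y)

transpose-injective : {n : ℕ} (x y : Fin n) → Inj (transpose x y)
transpose-injective x y {j} {k} eq = begin
  j                             ≡⟨ transpose-involutive x y j ⟨
  transpose x y (transpose x y j) ≡⟨ cong (transpose x y) eq ⟩
  transpose x y (transpose x y k) ≡⟨ transpose-involutive x y k ⟩
  k ∎
  where open ≡-Reasoning

-- Conjugation of a transposition, written without an inverse of `σ`. Thus `σ` may be any injection
-- between different sets, such as `suc` or the embedding of a few labels.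
transpose-conj : {m n : ℕ} (σ : Fin m → Fin n) → Inj σ → ∀ x y →
                 (σ ∘ transpose x y) ≗ (transpose (σ x) (σ y) ∘ σ)
transpose-conj σ inj x y k = go (k ≟F x) (k ≟F y)
  where
  go : Dec (k ≡ x) → Dec (k ≡ y) → σ (transpose x y k) ≡ transpose (σ x) (σ y) (σ k)
  go (yes refl) _ = trans (cong σ (transpose-fst x y)) (sym (transpose-fst (σ x) (σ y)))
  go _ (yes refl) = trans (cong σ (transpose-snd x y)) (sym (transpose-snd (σ x) (σ y)))
  go (no k≢x) (no k≢y) =
    trans (cong σ (transpose-other k≢x k≢y)) (sym (transpose-other (k≢x ∘ inj) (k≢y ∘ inj)))

-- Parity of the number of inversions

indicator : ℕ → ℕ → ℕ
indicator x y = if x <ᵇ y then 1 else 0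

below : {m : ℕ} → ℕ → (Fin m → ℕ) → ℕ
below {zero}  v f = 0
below {suc m} v f = indicator (f zero) v + below v (f ∘ suc)

-- A recursive form of `inversions`, suited to induction on `m`. Values are taken in `ℕ` because the
-- tail `f ∘ suc` of a permutation is no longer a permutation.
inversionCount : {m : ℕ} → (Fin m → ℕ) → ℕ
inversionCount {zero}  f = 0
inversionCount {suc m} f = below (f zero) (f ∘ suc) + inversionCount (f ∘ suc)

below-cong : {m : ℕ} (v : ℕ) {f g : Fin m → ℕ} → (∀ i → f i ≡ g i) → below v f ≡ below v g
below-cong {zero}  v e = refl
below-cong {suc m} v e = cong₂ _+_ (cong (λ z → indicator z v) (e zero)) (below-cong v (e ∘ suc))

inversionCount-cong : {m : ℕ} {f g : Fin m → ℕ} → (∀ i → f i ≡ g i) → inversionCount f ≡ inversionCount g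
inversionCount-cong {zero} e = refl
inversionCount-cong {suc m} {f} {g} e = cong₂ _+_
  (trans (cong (λ z → below z (f ∘ suc)) (e zero)) (below-cong (g zero) (e ∘ suc)))
  (inversionCount-cong (e ∘ suc))

sum-map-allFin-cong : {m : ℕ} {f g : Fin m → ℕ} → (∀ i → f i ≡ g i) →
                      sum (map f (allFin m)) ≡ sum (map g (allFin m))
sum-map-allFin-cong {m} e = cong sum (map-cong e (allFin m))

sum-map-allFin-suc : {m : ℕ} (f : Fin (suc m) → ℕ) →
                     sum (map f (allFin (suc m))) ≡ f zero + sum (map (f ∘ suc) (allFin m))
sum-map-allFin-suc f = cong (λ l → f zero + sum l) (trans (map-tabulate suc f) (sym (map-tabulate id (f ∘ suc))))

below-sum : {m : ℕ} (v : ℕ) (f : Fin m → ℕ) →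
            sum (map (λ j → if ⌊ f j <? v ⌋ then 1 else 0) (allFin m)) ≡ below v f
below-sum {zero}  v f = refl
below-sum {suc m} v f = trans (sum-map-allFin-suc (λ j → if ⌊ f j <? v ⌋ then 1 else 0))
  (cong₂ _+_ (cong (if_then 1 else 0) (isYes≗does (f zero <? v))) (below-sum v (f ∘ suc)))

-- By definition `inversions p` is `inversionsOf (toℕ ∘ p)`; the double sum is generalised so that
-- it too can be restricted to tails.
inversionsOf : {m : ℕ} → (Fin m → ℕ) → ℕ
inversionsOf {m} f = sum (map (λ i → sum (map (λ j →
  if ⌊ toℕ i <? toℕ j ⌋ then (if ⌊ f j <? f i ⌋ then 1 else 0) else 0)
  (allFin m))) (allFin m))

inversionsOf-inversionCount : {m : ℕ} (f : Fin m → ℕ) → inversionsOf f ≡ inversionCount f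
inversionsOf-inversionCount {zero}  f = refl
inversionsOf-inversionCount {suc m} f = begin
  inversionsOf f
    ≡⟨ sum-map-allFin-suc (λ i → sum (map (row i) (allFin (suc m)))) ⟩
  sum (map (row zero) (allFin (suc m))) + sum (map (λ i → sum (map (row (suc i)) (allFin (suc m)))) (allFin m))
    ≡⟨ cong₂ _+_ (trans (sum-map-allFin-suc (row zero)) (below-sum (f zero) (f ∘ suc)))
                 (sum-map-allFin-cong λ i → trans (sum-map-allFin-suc (row (suc i))) (sum-map-allFin-cong (shift i))) ⟩
  below (f zero) (f ∘ suc) + inversionsOf (f ∘ suc)
    ≡⟨ cong (below (f zero) (f ∘ suc) +_) (inversionsOf-inversionCount (f ∘ suc)) ⟩
  inversionCount f ∎
  where
  open ≡-Reasoning
  row : Fin (suc m) → Fin (suc m) → ℕ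
  row i j = if ⌊ toℕ i <? toℕ j ⌋ then (if ⌊ f j <? f i ⌋ then 1 else 0) else 0
  shift : ∀ i j → row (suc i) (suc j) ≡
          (if ⌊ toℕ i <? toℕ j ⌋ then (if ⌊ f (suc j) <? f (suc i) ⌋ then 1 else 0) else 0)
  shift i j = cong (λ b → if b then (if ⌊ f (suc j) <? f (suc i) ⌋ then 1 else 0) else 0)
    (trans (isYes≗does (suc (toℕ i) <? suc (toℕ j))) (sym (isYes≗does (toℕ i <? toℕ j))))

-- The number of values below `v` does not depend on their order; an adjacent exchange swaps two
-- neighbouring summands.
below-adjacent : {m : ℕ} (v : ℕ) (f : Fin (suc m) → ℕ) (k : Fin m) →
                 below v (f ∘ transpose (inject₁ k) (suc k)) ≡ below v f
below-adjacent {suc m} v f zero    =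
  regroup (indicator (f 1F) v) (indicator (f 0F) v) (below v λ i → f (suc (suc i)))
  where
  regroup : ∀ x y z → x + (y + z) ≡ y + (x + z)
  regroup = solve-∀
below-adjacent {suc m} v f (suc k) = cong (indicator (f zero) v +_) (trans
  (below-cong v λ i → cong f (sym (transpose-conj suc sucF-injective (inject₁ k) (suc k) i)))
  (below-adjacent v (f ∘ suc) k))

indicator-asym : ∀ x y → x ≢ y → (indicator x y ≡ 0 × indicator y x ≡ 1) ⊎ (indicator x y ≡ 1 × indicator y x ≡ 0)
indicator-asym x y x≢y with <-cmp x y
... | tri< x<y _ x≯y = inj₂ (cong (if_then 1 else 0) (dec-true (x <? y) x<y) , cong (if_then 1 else 0) (dec-false (y <? x) x≯y))
... | tri≈ _ x≡y _ = ⊥-elim (x≢y x≡y)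
... | tri> x≮y _ y<x = inj₁ (cong (if_then 1 else 0) (dec-false (x <? y) x≮y) , cong (if_then 1 else 0) (dec-true (y <? x) y<x))

⁻¹-parity : ∀ n → parity (suc n) ≡ parity n ⁻¹
⁻¹-parity n = trans (sym (⁻¹-involutive _)) (cong _⁻¹ (suc-homo-⁻¹ n))

-- Exchanging the first two values only moves summands, except for the one comparing these two values.
parity-inversionCount-adjacent : {m : ℕ} (f : Fin (suc m) → ℕ) (k : Fin m) → f (inject₁ k) ≢ f (suc k) →
                      parity (inversionCount (f ∘ transpose (inject₁ k) (suc k))) ≡ parity (inversionCount f) ⁻¹
parity-inversionCount-adjacent {suc m} f zero ne = flips _ _ (indicator-asym _ _ ne)
  where
  rest : Fin m → ℕ
  rest i = f (suc (suc i))
  A = below (f 0F) rest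
  B = below (f 1F) rest
  R = inversionCount rest
  regroup : ∀ x y z → x + (y + z) ≡ y + (x + z)
  regroup = solve-∀
  flips : ∀ u v → (u ≡ 0 × v ≡ 1) ⊎ (u ≡ 1 × v ≡ 0) →
          parity ((u + B) + (A + R)) ≡ parity ((v + A) + (B + R)) ⁻¹
  flips _ _ (inj₁ (refl , refl)) = begin
    parity (B + (A + R))           ≡⟨ cong parity (regroup B A R) ⟩
    parity (A + (B + R))           ≡⟨ suc-homo-⁻¹ (A + (B + R)) ⟨
    parity (suc (A + (B + R))) ⁻¹  ∎
    where open ≡-Reasoning
  flips _ _ (inj₂ (refl , refl)) = begin
    parity (suc (B + (A + R)))     ≡⟨ cong (parity ∘ suc) (regroup B A R) ⟩
    parity (suc (A + (B + R)))     ≡⟨ ⁻¹-parity (A + (B + R)) ⟩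
    parity (A + (B + R)) ⁻¹        ∎
    where open ≡-Reasoning
parity-inversionCount-adjacent {suc m} f (suc k) ne = begin
  parity (below (f zero) (f ∘ transpose (inject₁ (suc k)) (suc (suc k)) ∘ suc) + inversionCount (f ∘ transpose (inject₁ (suc k)) (suc (suc k)) ∘ suc))
    ≡⟨ cong parity (cong₂ _+_ (trans (below-cong (f zero) shift) (below-adjacent (f zero) (f ∘ suc) k)) (inversionCount-cong shift)) ⟩
  parity (b + inversionCount (f ∘ suc ∘ transpose (inject₁ k) (suc k)))
    ≡⟨ +-homo-+ b _ ⟩
  parity b +ℙ parity (inversionCount (f ∘ suc ∘ transpose (inject₁ k) (suc k)))
    ≡⟨ cong (parity b +ℙ_) (parity-inversionCount-adjacent (f ∘ suc) k ne) ⟩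
  parity b +ℙ parity (inversionCount (f ∘ suc)) ⁻¹
    ≡⟨ +-⁻¹ (parity b) _ ⟩
  (parity b +ℙ parity (inversionCount (f ∘ suc))) ⁻¹
    ≡⟨ cong _⁻¹ (+-homo-+ b _) ⟨
  parity (inversionCount f) ⁻¹ ∎
  where
  open ≡-Reasoning
  b = below (f zero) (f ∘ suc)
  shift : ∀ i → f (transpose (inject₁ (suc k)) (suc (suc k)) (suc i)) ≡ f (suc (transpose (inject₁ k) (suc k) i))
  shift i = cong f (sym (transpose-conj suc sucF-injective (inject₁ k) (suc k) i))
  +-⁻¹ : ∀ p q → p +ℙ q ⁻¹ ≡ (p +ℙ q) ⁻¹
  +-⁻¹ 0ℙ q = refl
  +-⁻¹ 1ℙ q = refl

sign : {n : ℕ} → (Fin n → Fin n) → Parity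
sign p = parity (inversionCount (toℕ ∘ p))

sign-cong : {n : ℕ} {p q : Fin n → Fin n} → p ≗ q → sign p ≡ sign q
sign-cong e = cong parity (inversionCount-cong (cong toℕ ∘ e))

sign-transpose< : {n : ℕ} (d : ℕ) (p : Fin n → Fin n) → Inj p → ∀ x y → toℕ y ≡ suc d + toℕ x →
                  sign (p ∘ transpose x y) ≡ sign p ⁻¹
sign-transpose< {suc n} d p p-inj x (suc k) eq = go d eq
  where
  y = suc k
  y′ = inject₁ k
  go : ∀ d → toℕ y ≡ suc d + toℕ x → sign (p ∘ transpose x y) ≡ sign p ⁻¹
  go zero eq with toℕ-injective {i = x} {j = y′} (trans (sym (suc-injective eq)) (sym (toℕ-inject₁ k)))
  ... | refl = parity-inversionCount-adjacent (toℕ ∘ p) k λ e → y′≢y (p-inj (toℕ-injective e))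
    where
    y′≢y : y′ ≢ y
    y′≢y e = <⇒≢ (n<1+n (toℕ k)) (trans (sym (toℕ-inject₁ k)) (cong toℕ e))
  -- (x y) = (y′ y)(x y′)(y′ y)
  go (suc d) eq = begin
    sign (p ∘ transpose x y)
      ≡⟨ sign-cong (cong p ∘ decomposed) ⟩
    sign (p ∘ τ ∘ transpose x y′ ∘ τ)
      ≡⟨ parity-inversionCount-adjacent (toℕ ∘ p ∘ τ ∘ transpose x y′) k
           (λ e → y′≢y (transpose-injective x y′ (transpose-injective y′ y (p-inj (toℕ-injective e))))) ⟩
    sign (p ∘ τ ∘ transpose x y′) ⁻¹
      ≡⟨ cong _⁻¹ (sign-transpose< d (p ∘ τ) (transpose-injective y′ y ∘ p-inj) x y′ y′-eq) ⟩
    (sign (p ∘ τ) ⁻¹) ⁻¹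
      ≡⟨ cong (_⁻¹ ∘ _⁻¹) (parity-inversionCount-adjacent (toℕ ∘ p) k (λ e → y′≢y (p-inj (toℕ-injective e)))) ⟩
    ((sign p ⁻¹) ⁻¹) ⁻¹
      ≡⟨ ⁻¹-involutive _ ⟩
    sign p ⁻¹ ∎
    where
    open ≡-Reasoning
    τ = transpose y′ y
    y′-eq : toℕ y′ ≡ suc d + toℕ x
    y′-eq = trans (toℕ-inject₁ k) (cong (_∸ 1) eq)
    y′≢y : y′ ≢ y
    y′≢y e = <⇒≢ (n<1+n (toℕ k)) (trans (sym (toℕ-inject₁ k)) (cong toℕ e))
    x≢y′ : x ≢ y′
    x≢y′ refl = <⇒≢ (s≤s (m≤n+m (toℕ x) d)) y′-eq
    x≢y : x ≢ y
    x≢y refl = <⇒≢ (s≤s (m≤n+m (toℕ y) (suc d))) eq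
    decomposed : transpose x y ≗ (τ ∘ transpose x y′ ∘ τ)
    decomposed i = sym (begin
      τ (transpose x y′ (τ i))              ≡⟨ transpose-conj τ (transpose-injective y′ y) x y′ (τ i) ⟩
      transpose (τ x) (τ y′) (τ (τ i))      ≡⟨ cong (transpose (τ x) (τ y′)) (transpose-involutive y′ y i) ⟩
      transpose (τ x) (τ y′) i              ≡⟨ cong₂ (λ u v → transpose u v i) (transpose-other x≢y′ x≢y) (transpose-fst y′ y) ⟩
      transpose x y i                       ∎)

sign-transpose : {n : ℕ} (p : Fin n → Fin n) → Inj p → ∀ {x y} → x ≢ y →
                 sign (p ∘ transpose x y) ≡ sign p ⁻¹
sign-transpose p p-inj {x} {y} x≢y with <-cmp (toℕ x) (toℕ y)
... | tri< x<y _ _ = sign-transpose< (toℕ y ∸ suc (toℕ x)) p p-inj x y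
                       (sym (trans (sym (+-suc _ (toℕ x))) (m∸n+n≡m x<y)))
... | tri≈ _ x≡y _ = ⊥-elim (x≢y (toℕ-injective x≡y))
... | tri> _ _ y<x = trans (sign-cong (cong p ∘ transpose-comm x y))
                       (sign-transpose< (toℕ x ∸ suc (toℕ y)) p p-inj y x
                         (sym (trans (sym (+-suc _ (toℕ y))) (m∸n+n≡m y<x))))

inversionCount-id : ∀ m → inversionCount {m} toℕ ≡ 0
inversionCount-id m = increasing {m} toℕ (λ i<j → i<j)
  where
  below-0 : ∀ {m} v (f : Fin m → ℕ) → (∀ i → v ≤ f i) → below v f ≡ 0
  below-0 {zero} v f v≤f = refl
  below-0 {suc m} v f v≤f = cong₂ _+_ (cong (if_then 1 else 0) (dec-false (f zero <? v) (≤⇒≯ (v≤f zero))))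
    (below-0 v (f ∘ suc) (v≤f ∘ suc))
  -- The induction runs over increasing functions, since the tail of `toℕ` is `toℕ ∘ suc` and not
  -- `toℕ` itself.
  increasing : ∀ {m} (f : Fin m → ℕ) → (∀ {i j} → toℕ i < toℕ j → f i < f j) → inversionCount f ≡ 0
  increasing {zero} f inc = refl
  increasing {suc m} f inc = cong₂ _+_ (below-0 (f zero) (f ∘ suc) (λ i → <⇒≤ (inc (z<s {n = toℕ i}))))
    (increasing (f ∘ suc) (inc ∘ s<s))

sign-id : ∀ {m} → sign {m} id ≡ 0ℙ
sign-id {m} = cong parity (inversionCount-id m)

parity-% : ∀ n → parity n ≡ parity (n % 2)
parity-% 0 = refl
parity-% 1 = refl
parity-% (suc (suc n)) = parity-% n

%2-cases : ∀ n → n % 2 ≡ 0 × parity n ≡ 0ℙ ⊎ n % 2 ≡ 1 × parity n ≡ 1ℙ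
%2-cases 0 = inj₁ (refl , refl)
%2-cases 1 = inj₂ (refl , refl)
%2-cases (suc (suc n)) = %2-cases n

even⇒sign : {n : ℕ} (p : Fin n → Fin n) → IsEven p → sign p ≡ 0ℙ
even⇒sign p ev = trans (cong parity (sym (inversionsOf-inversionCount (toℕ ∘ p)))) (trans (parity-% (inversions p)) (cong parity ev))

sign⇒even : {n : ℕ} (p : Fin n → Fin n) → sign p ≡ 0ℙ → IsEven p
sign⇒even p s with %2-cases (inversions p)
... | inj₁ (ev , _) = ev
... | inj₂ (_ , odd) with trans (sym odd) (trans (cong parity (inversionsOf-inversionCount (toℕ ∘ p))) s)
...   | ()

-- Words in the two cycles

cycUp-step : ∀ {lo hi i} → lo ≤ i → i < hi → cycUp lo hi i ≡ suc i
cycUp-step {lo} {hi} {i} lo≤i i<hi with lo ≤? i | i <? hi | i ≟ hi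
... | yes _ | yes _ | _ = refl
... | yes _ | no i≮hi | _ = ⊥-elim (i≮hi i<hi)
... | no lo≰i | _ | _ = ⊥-elim (lo≰i lo≤i)

cycUp-top : ∀ {lo hi} → lo ≤ hi → cycUp lo hi hi ≡ lo
cycUp-top {lo} {hi} lo≤hi with lo ≤? hi | hi <? hi | hi ≟ hi
... | yes _ | yes hi<hi | _ = ⊥-elim (<-irrefl refl hi<hi)
... | yes _ | no _ | yes _ = refl
... | yes _ | no _ | no hi≢hi = ⊥-elim (hi≢hi refl)
... | no lo≰hi | _ | _ = ⊥-elim (lo≰hi lo≤hi)

cycUp-below : ∀ {lo hi i} → i < lo → cycUp lo hi i ≡ i
cycUp-below {lo} {hi} {i} i<lo with lo ≤? i | i <? hi | i ≟ hi
... | yes lo≤i | _ | _ = ⊥-elim (<⇒≱ i<lo lo≤i)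
... | no _ | yes _ | _ = refl
... | no _ | no _ | _ = refl

cycUp-above : ∀ {lo hi i} → hi < i → cycUp lo hi i ≡ i
cycUp-above {lo} {hi} {i} hi<i with lo ≤? i | i <? hi | i ≟ hi
... | _ | yes i<hi | _ = ⊥-elim (<-asym hi<i i<hi)
... | _ | no _ | yes refl = ⊥-elim (<-irrefl refl hi<i)
... | yes _ | no _ | no _ = refl
... | no _ | no _ | no _ = refl

cycDown-step : ∀ {lo hi i} → lo ≤ i → i < hi → cycDown lo hi (suc i) ≡ i
cycDown-step {lo} {hi} {i} lo≤i i<hi with lo <? suc i | suc i ≤? hi | suc i ≟ lo
... | yes _ | yes _ | _ = refl
... | yes _ | no i≮hi | _ = ⊥-elim (i≮hi i<hi)
... | no lo≮si | _ | _ = ⊥-elim (lo≮si (s≤s lo≤i))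

cycDown-bottom : ∀ lo hi → cycDown lo hi lo ≡ hi
cycDown-bottom lo hi with lo <? lo | lo ≤? hi | lo ≟ lo
... | yes lo<lo | _ | _ = ⊥-elim (<-irrefl refl lo<lo)
... | no _ | _ | yes _ = refl
... | no _ | _ | no lo≢lo = ⊥-elim (lo≢lo refl)

cycDown-below : ∀ {lo hi i} → i < lo → cycDown lo hi i ≡ i
cycDown-below {lo} {hi} {i} i<lo with lo <? i | i ≤? hi | i ≟ lo
... | yes lo<i | _ | _ = ⊥-elim (<-asym i<lo lo<i)
... | no _ | _ | yes refl = ⊥-elim (<-irrefl refl i<lo)
... | no _ | yes _ | no _ = refl
... | no _ | no _ | no _ = refl

cycDown-above : ∀ {lo hi i} → lo ≤ hi → hi < i → cycDown lo hi i ≡ i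
cycDown-above {lo} {hi} {i} lo≤hi hi<i with lo <? i | i ≤? hi | i ≟ lo
... | _ | yes i≤hi | _ = ⊥-elim (<⇒≱ hi<i i≤hi)
... | yes _ | no _ | _ = refl
... | no lo≮i | no _ | _ = ⊥-elim (lo≮i (≤-<-trans lo≤hi hi<i))

data CyclePosition (lo hi : ℕ) : ℕ → Set where
  under  : ∀ {i} → i < lo → CyclePosition lo hi i
  inside : ∀ {i} → lo ≤ i → i < hi → CyclePosition lo hi i
  top    : CyclePosition lo hi hi
  over   : ∀ {i} → hi < i → CyclePosition lo hi i

cyclePosition : ∀ lo hi i → CyclePosition lo hi i
cyclePosition lo hi i with lo ≤? i | <-cmp i hi
... | no lo≰i  | _              = under (≰⇒> lo≰i)
... | yes lo≤i | tri< i<hi _ _  = inside lo≤i i<hi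
... | yes _    | tri≈ _ refl _  = top
... | yes _    | tri> _ _ hi<i  = over hi<i

cycDown-cycUp : ∀ {lo hi} → lo ≤ hi → ∀ i → cycDown lo hi (cycUp lo hi i) ≡ i
cycDown-cycUp {lo} {hi} lo≤hi i with cyclePosition lo hi i
... | under i<lo = trans (cong (cycDown lo hi) (cycUp-below i<lo)) (cycDown-below i<lo)
... | inside lo≤i i<hi = trans (cong (cycDown lo hi) (cycUp-step lo≤i i<hi)) (cycDown-step lo≤i i<hi)
... | top = trans (cong (cycDown lo hi) (cycUp-top lo≤hi)) (cycDown-bottom lo hi)
... | over hi<i = trans (cong (cycDown lo hi) (cycUp-above {lo} hi<i)) (cycDown-above lo≤hi hi<i)

cycUp-cycDown : ∀ {lo hi} → lo ≤ hi → ∀ i → cycUp lo hi (cycDown lo hi i) ≡ i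
cycUp-cycDown {lo} {hi} lo≤hi i with <-cmp i lo | ≤-<-connex i hi
... | tri< i<lo _ _ | _ = trans (cong (cycUp lo hi) (cycDown-below i<lo)) (cycUp-below i<lo)
... | tri≈ _ refl _ | _ = trans (cong (cycUp lo hi) (cycDown-bottom lo hi)) (cycUp-top lo≤hi)
... | tri> _ _ (s≤s lo≤i) | inj₁ i≤hi = trans (cong (cycUp lo hi) (cycDown-step lo≤i i≤hi)) (cycUp-step lo≤i i≤hi)
... | tri> _ _ _ | inj₂ hi<i = trans (cong (cycUp lo hi) (cycDown-above lo≤hi hi<i)) (cycUp-above {lo} hi<i)

cycUp-< : ∀ {lo hi n i} → lo ≤ hi → hi < n → i < n → cycUp lo hi i < n
cycUp-< {lo} {hi} {n} {i} lo≤hi hi<n i<n with cyclePosition lo hi i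
... | under i<lo = subst (_< n) (sym (cycUp-below i<lo)) i<n
... | inside lo≤i i<hi = subst (_< n) (sym (cycUp-step lo≤i i<hi)) (≤-<-trans i<hi hi<n)
... | top = subst (_< n) (sym (cycUp-top lo≤hi)) (≤-<-trans lo≤hi hi<n)
... | over hi<i = subst (_< n) (sym (cycUp-above {lo} hi<i)) i<n

cycDown-< : ∀ {lo hi n i} → lo ≤ hi → hi < n → i < n → cycDown lo hi i < n
cycDown-< {lo} {hi} {n} {i} lo≤hi hi<n i<n with <-cmp i lo | ≤-<-connex i hi
... | tri< i<lo _ _ | _ = subst (_< n) (sym (cycDown-below i<lo)) i<n
... | tri≈ _ refl _ | _ = subst (_< n) (sym (cycDown-bottom lo hi)) hi<n
... | tri> _ _ (s≤s lo≤i) | inj₁ i≤hi = subst (_< n) (sym (cycDown-step lo≤i i≤hi)) (<-trans (n<1+n _) i<n)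
... | tri> _ _ _ | inj₂ hi<i = subst (_< n) (sym (cycDown-above lo≤hi hi<i)) i<n

toℕ-liftFin : {n : ℕ} (f : ℕ → ℕ) (i : Fin n) → f (toℕ i) < n → toℕ (liftFin f i) ≡ f (toℕ i)
toℕ-liftFin {n} f i fi<n with f (toℕ i) <? n
... | yes p = toℕ-fromℕ< p
... | no fi≮n = ⊥-elim (fi≮n fi<n)

inverse : Gen → Gen
inverse α   = α⁻¹
inverse α⁻¹ = α
inverse β   = β⁻¹
inverse β⁻¹ = β

inverse-involutive : ∀ g → inverse (inverse g) ≡ g
inverse-involutive α   = refl
inverse-involutive α⁻¹ = refl
inverse-involutive β   = refl
inverse-involutive β⁻¹ = refl

invert : List Gen → List Gen
invert []      = []
invert (g ∷ w) = invert w ++ inverse g ∷ []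

length-invert : ∀ w → length (invert w) ≡ length w
length-invert []      = refl
length-invert (g ∷ w) = begin
  length (invert w ++ inverse g ∷ []) ≡⟨ length-++ (invert w) ⟩
  length (invert w) + 1               ≡⟨ +-comm _ 1 ⟩
  suc (length (invert w))             ≡⟨ cong suc (length-invert w) ⟩
  suc (length w)                      ∎
  where open ≡-Reasoning

-- The head of a word acts first, so concatenation turns into composition in the opposite order.
eval-++ : ∀ a b v w → eval a b (v ++ w) ≗ (eval a b w ∘ eval a b v)
eval-++ a b []      w i = refl
eval-++ a b (g ∷ v) w i = eval-++ a b v w (gen a b g i)

-- The four points may coincide: sharing one gives a three-cycle, and `z` equal to `w` leaves a
-- single transposition. One conjugation lemma therefore serves all three kinds of permutation.
doubleTransposition : {n : ℕ} → Fin n → Fin n → Fin n → Fin n → Fin n → Fin n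
doubleTransposition x y z w = transpose x y ∘ transpose z w

-- x ↦ y ↦ z ↦ x
threeCycle : {n : ℕ} → Fin n → Fin n → Fin n → Fin n → Fin n
threeCycle x y z = doubleTransposition x y y z

doubleTransposition-conj : {m n : ℕ} (σ : Fin m → Fin n) → Inj σ → ∀ x y z w →
  (σ ∘ doubleTransposition x y z w) ≗ (doubleTransposition (σ x) (σ y) (σ z) (σ w) ∘ σ)
doubleTransposition-conj σ inj x y z w k = trans
  (transpose-conj σ inj x y (transpose z w k))
  (cong (transpose (σ x) (σ y)) (transpose-conj σ inj z w k))

-- a = 2 + p and b = 2 + q; the points common to both cycles are p and suc p.
module Puzzle (p q : ℕ) where

  N : ℕ
  N = nV (2 + p) (2 + q)

  N≡ : N ≡ suc (p + suc q)
  N≡ = +-suc p (suc q)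

  last<N : p + suc q < N
  last<N = ≤-reflexive (sym N≡)

  <N : ∀ {i} → i ≤ p + suc q → i < N
  <N i≤last = ≤-<-trans i≤last last<N

  <N⇒≤ : ∀ {i} → i < N → i ≤ p + suc q
  <N⇒≤ {i} i<N = ≤-pred (subst (i <_) N≡ i<N)

  E : List Gen → Fin N → Fin N
  E = eval (2 + p) (2 + q)

  genℕ : Gen → ℕ → ℕ
  genℕ α   = cycUp 0 (suc p)
  genℕ α⁻¹ = cycDown 0 (suc p)
  genℕ β   = cycUp p (p + suc q)
  genℕ β⁻¹ = cycDown p (p + suc q)

  -- The same action on plain positions, where a point is traced using inequalities alone; `toℕ-E`
  -- carries the results back to `Fin N`.
  evalℕ : List Gen → ℕ → ℕ
  evalℕ []      i = i
  evalℕ (g ∷ w) i = evalℕ w (genℕ g i)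

  evalℕ-++ : ∀ v w i → evalℕ (v ++ w) i ≡ evalℕ w (evalℕ v i)
  evalℕ-++ []      w i = refl
  evalℕ-++ (g ∷ v) w i = evalℕ-++ v w (genℕ g i)

  p≤last : p ≤ p + suc q
  p≤last = m≤m+n p (suc q)

  sp≤last : suc p ≤ p + suc q
  sp≤last = subst (suc p ≤_) (sym (+-suc p q)) (s≤s (m≤m+n p q))

  genℕ-< : ∀ g {i} → i < N → genℕ g i < N
  genℕ-< α   = cycUp-< z≤n (<N sp≤last)
  genℕ-< α⁻¹ = cycDown-< z≤n (<N sp≤last)
  genℕ-< β   = cycUp-< p≤last last<N
  genℕ-< β⁻¹ = cycDown-< p≤last last<N

  toℕ-gen : ∀ g i → toℕ (gen (2 + p) (2 + q) g i) ≡ genℕ g (toℕ i)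
  toℕ-gen α   i = toℕ-liftFin _ i (genℕ-< α (toℕ<n i))
  toℕ-gen α⁻¹ i = toℕ-liftFin _ i (genℕ-< α⁻¹ (toℕ<n i))
  -- The top of the second cycle is given as `N ∸ 1`; rewriting turns it into `p + suc q`.
  toℕ-gen β   i rewrite cong (_∸ 1) N≡ = toℕ-liftFin _ i (genℕ-< β (toℕ<n i))
  toℕ-gen β⁻¹ i rewrite cong (_∸ 1) N≡ = toℕ-liftFin _ i (genℕ-< β⁻¹ (toℕ<n i))

  toℕ-E : ∀ w i → toℕ (E w i) ≡ evalℕ w (toℕ i)
  toℕ-E []      i = refl
  toℕ-E (g ∷ w) i = trans (toℕ-E w _) (cong (evalℕ w) (toℕ-gen g i))

  genℕ-inverse : ∀ g i → genℕ (inverse g) (genℕ g i) ≡ i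
  genℕ-inverse α   = cycDown-cycUp {hi = suc p} z≤n
  genℕ-inverse α⁻¹ = cycUp-cycDown {hi = suc p} z≤n
  genℕ-inverse β   = cycDown-cycUp p≤last
  genℕ-inverse β⁻¹ = cycUp-cycDown p≤last

  evalℕ-invert : ∀ w i → evalℕ (invert w) (evalℕ w i) ≡ i
  evalℕ-invert []      i = refl
  evalℕ-invert (g ∷ w) i = begin
    evalℕ (invert w ++ inverse g ∷ []) (evalℕ w (genℕ g i)) ≡⟨ evalℕ-++ (invert w) _ _ ⟩
    genℕ (inverse g) (evalℕ (invert w) (evalℕ w (genℕ g i))) ≡⟨ cong (genℕ (inverse g)) (evalℕ-invert w _) ⟩
    genℕ (inverse g) (genℕ g i)                              ≡⟨ genℕ-inverse g i ⟩
    i ∎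
    where open ≡-Reasoning

  evalℕ-invertʳ : ∀ w i → evalℕ w (evalℕ (invert w) i) ≡ i
  evalℕ-invertʳ []      i = refl
  evalℕ-invertʳ (g ∷ w) i = begin
    evalℕ w (genℕ g (evalℕ (invert w ++ inverse g ∷ []) i))        ≡⟨ cong (evalℕ w ∘ genℕ g) (evalℕ-++ (invert w) _ i) ⟩
    evalℕ w (genℕ g (genℕ (inverse g) (evalℕ (invert w) i)))       ≡⟨ cong (λ h → evalℕ w (genℕ h (genℕ (inverse g) (evalℕ (invert w) i)))) (inverse-involutive g) ⟨
    evalℕ w (genℕ (inverse (inverse g)) (genℕ (inverse g) (evalℕ (invert w) i))) ≡⟨ cong (evalℕ w) (genℕ-inverse (inverse g) _) ⟩
    evalℕ w (evalℕ (invert w) i)                                   ≡⟨ evalℕ-invertʳ w i ⟩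
    i ∎
    where open ≡-Reasoning

  E-invert : ∀ w → (E (invert w) ∘ E w) ≗ id
  E-invert w i = toℕ-injective (trans (toℕ-E (invert w) _) (trans (cong (evalℕ (invert w)) (toℕ-E w i)) (evalℕ-invert w _)))

  E-invertʳ : ∀ w → (E w ∘ E (invert w)) ≗ id
  E-invertʳ w i = toℕ-injective (trans (toℕ-E w _) (trans (cong (evalℕ w) (toℕ-E (invert w) i)) (evalℕ-invertʳ w _)))

  E-injective : ∀ w → Inj (E w)
  E-injective w {x} {y} e = trans (sym (E-invert w x)) (trans (cong (E (invert w)) e) (E-invert w y))

  inConfig⇒perm : ∀ {f} → InConfig (2 + p) (2 + q) f → IsPerm f
  inConfig⇒perm (w , e) =
    (λ {x} {y} fx≡fy → E-injective w (trans (e x) (trans fx≡fy (sym (e y))))) ,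
    (λ y → E (invert w) y , λ { refl → trans (sym (e _)) (E-invertʳ w y) })

  -- Closure properties of bounded generation

  G : ℕ → (Fin N → Fin N) → Set
  G = GeneratedIn (2 + p) (2 + q)

  G-resp : ∀ {K f g} → f ≗ g → G K f → G K g
  G-resp f≗g (w , l , e) = w , l , λ i → trans (e i) (f≗g i)

  G-mono : ∀ {K L f} → K ≤ L → G K f → G L f
  G-mono K≤L (w , l , e) = w , ≤-trans l K≤L , e

  G-comp : ∀ {K L f g} → G K f → G L g → G (K + L) (f ∘ g)
  G-comp {K} {L} {f} {g} (v , lv , ev) (w , lw , ew) = w ++ v ,
    ≤-trans (≤-reflexive (length-++ w)) (≤-trans (+-mono-≤ lw lv) (≤-reflexive (+-comm L K))) ,
    λ i → trans (eval-++ _ _ w v i) (trans (ev _) (cong f (ew i)))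

  G-id : ∀ {K} → G K id
  G-id = [] , z≤n , λ _ → refl

  G-conj : ∀ {K x y z u} → G K (doubleTransposition x y z u) → ∀ w →
           G (length w + (K + length w)) (doubleTransposition (E w x) (E w y) (E w z) (E w u))
  G-conj {x = x} {y} {z} {u} D w = G-resp conjugate
    (G-comp (w , ≤-refl , λ _ → refl) (G-comp D (invert w , ≤-reflexive (length-invert w) , λ _ → refl)))
    where
    conjugate : (E w ∘ doubleTransposition x y z u ∘ E (invert w)) ≗ doubleTransposition (E w x) (E w y) (E w z) (E w u)
    conjugate i = trans (doubleTransposition-conj (E w) (E-injective w) x y z u _)
      (cong (doubleTransposition (E w x) (E w y) (E w z) (E w u)) (E-invertʳ w i))

  -- Transitivity on ordered pairs by words of linear length

  runα : ∀ k {x} → k + x ≤ suc p → evalℕ (replicate k α) x ≡ k + x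
  runα zero    _ = refl
  runα (suc k) {x} k+x≤ = begin
    evalℕ (replicate k α) (genℕ α x) ≡⟨ cong (evalℕ (replicate k α)) (cycUp-step z≤n (≤-trans (s≤s (m≤n+m x k)) k+x≤)) ⟩
    evalℕ (replicate k α) (suc x)    ≡⟨ runα k (subst (_≤ suc p) (sym (+-suc k x)) k+x≤) ⟩
    k + suc x                        ≡⟨ +-suc k x ⟩
    suc k + x                        ∎
    where open ≡-Reasoning

  runβ : ∀ k {x} → p ≤ x → k + x ≤ p + suc q → evalℕ (replicate k β) x ≡ k + x
  runβ zero    _ _ = refl
  runβ (suc k) {x} p≤x k+x≤ = begin
    evalℕ (replicate k β) (genℕ β x) ≡⟨ cong (evalℕ (replicate k β)) (cycUp-step p≤x (≤-trans (s≤s (m≤n+m x k)) k+x≤)) ⟩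
    evalℕ (replicate k β) (suc x)    ≡⟨ runβ k (m≤n⇒m≤1+n p≤x) (subst (_≤ p + suc q) (sym (+-suc k x)) k+x≤) ⟩
    k + suc x                        ≡⟨ +-suc k x ⟩
    suc k + x                        ∎
    where open ≡-Reasoning

  βlast : genℕ β (p + suc q) ≡ p
  βlast = cycUp-top p≤last

  βp : genℕ β p ≡ suc p
  βp = cycUp-step ≤-refl sp≤last

  -- A point up to `suc p` climbs along `α`. A point beyond climbs along `β` to the last position,
  -- and two further shifts take it through `p` to `suc p`.
  toShared : ∀ x → x < N → ∃ λ w → length w ≤ N × evalℕ w x ≡ suc p
  toShared x x<N with x ≤? suc p
  ... | yes x≤sp = replicate k α , ≤-trans (≤-reflexive (length-replicate k)) (≤-trans (m∸n≤m (suc p) x) (<⇒≤ (<N sp≤last))) ,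
                   trans (runα k (≤-reflexive (m∸n+n≡m x≤sp))) (m∸n+n≡m x≤sp)
    where k = suc p ∸ x
  ... | no x≰sp = replicate k β ++ β ∷ β ∷ [] , length≤ , moves
    where
    k = p + suc q ∸ x
    sp<x = ≰⇒> x≰sp
    x≤last = <N⇒≤ x<N
    length≤ : length (replicate k β ++ β ∷ β ∷ []) ≤ N
    length≤ = begin
      length (replicate k β ++ β ∷ β ∷ []) ≡⟨ length-++ (replicate k β) ⟩
      length (replicate k β) + 2           ≡⟨ cong (_+ 2) (length-replicate k) ⟩
      -- The two extra shifts are paid for by `x`, which exceeds `suc p` and so is at least 2.
      k + 2                                ≤⟨ +-monoʳ-≤ k (≤-trans (s≤s (s≤s z≤n)) sp<x) ⟩
      k + x                                ≡⟨ m∸n+n≡m x≤last ⟩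
      p + suc q                            ≤⟨ <⇒≤ last<N ⟩
      N                                    ∎
      where open ≤-Reasoning
    moves : evalℕ (replicate k β ++ β ∷ β ∷ []) x ≡ suc p
    moves = begin
      evalℕ (replicate k β ++ β ∷ β ∷ []) x      ≡⟨ evalℕ-++ (replicate k β) _ x ⟩
      genℕ β (genℕ β (evalℕ (replicate k β) x))  ≡⟨ cong (genℕ β ∘ genℕ β) (runβ k (<⇒≤ (<-trans (n<1+n p) sp<x)) (≤-reflexive (m∸n+n≡m x≤last))) ⟩
      genℕ β (genℕ β (k + x))                    ≡⟨ cong (genℕ β ∘ genℕ β) (m∸n+n≡m x≤last) ⟩
      genℕ β (genℕ β (p + suc q))                ≡⟨ cong (genℕ β) βlast ⟩
      genℕ β p                                   ≡⟨ βp ⟩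
      suc p                                      ∎
      where open ≡-Reasoning

  -- α⁻¹ followed by β fixes suc p and is a cycle on the other points, whence 2-transitivity.
  rotation : ℕ → List Gen
  rotation zero    = []
  rotation (suc k) = α⁻¹ ∷ β ∷ rotation k

  length-rotation : ∀ k → length (rotation k) ≡ 2 * k
  length-rotation zero    = refl
  length-rotation (suc k) = trans (cong (2 +_) (length-rotation k)) (sym (*-suc 2 k))

  rotation-fixes : ∀ k → evalℕ (rotation k) (suc p) ≡ suc p
  rotation-fixes zero    = refl
  rotation-fixes (suc k) = begin
    evalℕ (rotation k) (genℕ β (genℕ α⁻¹ (suc p))) ≡⟨ cong (evalℕ (rotation k) ∘ genℕ β) (cycDown-step z≤n ≤-refl) ⟩
    evalℕ (rotation k) (genℕ β p)                  ≡⟨ cong (evalℕ (rotation k)) βp ⟩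
    evalℕ (rotation k) (suc p)                     ≡⟨ rotation-fixes k ⟩
    suc p ∎
    where open ≡-Reasoning

  -- Beyond `suc p` only `β` acts: `d` rounds lead to the last position and one more wraps around to
  -- `p`.
  rotation-up : ∀ d y → suc p < y → d + y ≡ p + suc q → evalℕ (rotation (suc d)) y ≡ p
  rotation-up zero y sp<y refl = trans (cong (genℕ β) (cycDown-above z≤n sp<y)) βlast
  rotation-up (suc d) y sp<y eq = begin
    evalℕ (rotation (suc d)) (genℕ β (genℕ α⁻¹ y)) ≡⟨ cong (evalℕ (rotation (suc d)) ∘ genℕ β) (cycDown-above z≤n sp<y) ⟩
    evalℕ (rotation (suc d)) (genℕ β y)            ≡⟨ cong (evalℕ (rotation (suc d))) (cycUp-step (<⇒≤ (<-trans (n<1+n p) sp<y)) (≤-trans (s≤s (m≤n+m y d)) (≤-reflexive eq))) ⟩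
    evalℕ (rotation (suc d)) (suc y)               ≡⟨ rotation-up d (suc y) (m≤n⇒m≤1+n sp<y) (trans (+-suc d y) eq) ⟩
    p ∎
    where open ≡-Reasoning

  -- Below `p` each round lowers the point by one, since `β` fixes the result. After `y` rounds it
  -- is at 0; the next round sends it through `suc p` onto the far part of `β`, or straight to `p`
  -- if `q` is 0, and `q` rounds of `rotation-up` remain.
  rotation-down : ∀ y → y < p → evalℕ (rotation (suc y + q)) y ≡ p
  rotation-down (suc y) y<p = begin
    evalℕ (rotation (suc y + q)) (genℕ β (genℕ α⁻¹ (suc y))) ≡⟨ cong (evalℕ (rotation (suc y + q)) ∘ genℕ β) (cycDown-step z≤n (<-trans (n<1+n y) (m≤n⇒m≤1+n y<p))) ⟩
    evalℕ (rotation (suc y + q)) (genℕ β y) ≡⟨ cong (evalℕ (rotation (suc y + q))) (cycUp-below (<-trans (n<1+n y) y<p)) ⟩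
    evalℕ (rotation (suc y + q)) y ≡⟨ rotation-down y (<-trans (n<1+n y) y<p) ⟩
    p ∎
    where open ≡-Reasoning
  rotation-down zero _ = trans (cong (evalℕ (rotation q) ∘ genℕ β) (cycDown-bottom 0 (suc p))) (go q refl)
    where
    go : ∀ r → q ≡ r → evalℕ (rotation r) (genℕ β (suc p)) ≡ p
    go zero refl = trans (cong (genℕ β) (sym (+-comm p 1))) βlast
    go (suc r) refl = trans
      (cong (evalℕ (rotation (suc r))) (cycUp-step (n≤1+n p) (subst (suc (suc p) ≤_) (sym last≡) (s≤s (s≤s (m≤n+m p r))))))
      (rotation-up r (suc (suc p)) ≤-refl (trans (trans (+-suc r (suc p)) (cong suc (+-suc r p))) (sym last≡)))
      where
      last≡ : p + suc (suc r) ≡ suc (suc (r + p))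
      last≡ = trans (+-suc p (suc r)) (cong suc (trans (+-suc p r) (cong suc (+-comm p r))))

  rotate : ∀ y → y < N → y ≢ suc p → ∃ λ k → k ≤ N × evalℕ (rotation k) y ≡ p
  rotate y y<N y≢sp with <-cmp y p
  ... | tri< y<p _ _ = suc y + q , ≤-trans (s≤s (+-mono-≤ (<⇒≤ y<p) (n≤1+n q))) (≤-reflexive (sym N≡)) , rotation-down y y<p
  ... | tri≈ _ refl _ = 0 , z≤n , refl
  ... | tri> _ _ p<y = suc d , ≤-trans (s≤s (m∸n≤m (p + suc q) y)) (≤-reflexive (sym N≡)) ,
                       rotation-up d y (≤∧≢⇒< p<y (≢-sym y≢sp)) (m∸n+n≡m (<N⇒≤ y<N))
    where d = p + suc q ∸ y

  -- First `x` is brought to `suc p`; the rotation then fixes it there while bringing `y` to `p`. A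
  -- round of the rotation has two letters, whence `N + 2 * N`.
  toShared₂ : ∀ {x y : Fin N} → x ≢ y →
              ∃ λ w → length w ≤ 3 * N × toℕ (E w x) ≡ suc p × toℕ (E w y) ≡ p
  toShared₂ {x} {y} x≢y with toShared (toℕ x) (toℕ<n x)
  ... | v , lv , ev with rotate (toℕ (E v y)) (toℕ<n (E v y)) (λ e → x≢y (E-injective v (toℕ-injective (trans (toℕ-E v x) (trans ev (sym e))))))
  ... | k , k≤N , ek = v ++ rotation k , length≤ , moves x (trans (cong (evalℕ (rotation k)) (trans (toℕ-E v x) ev)) (rotation-fixes k)) , moves y ek
    where
    moves : ∀ {t} z → evalℕ (rotation k) (toℕ (E v z)) ≡ t → toℕ (E (v ++ rotation k) z) ≡ t
    moves z e = trans (cong toℕ (eval-++ _ _ v (rotation k) z)) (trans (toℕ-E (rotation k) (E v z)) e)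
    length≤ : length (v ++ rotation k) ≤ 3 * N
    length≤ = begin
      length (v ++ rotation k)       ≡⟨ length-++ v ⟩
      length v + length (rotation k) ≡⟨ cong (length v +_) (length-rotation k) ⟩
      length v + 2 * k               ≤⟨ +-mono-≤ lv (*-monoʳ-≤ 2 k≤N) ⟩
      3 * N                          ∎
      where open ≤-Reasoning

  -- Both ordered pairs are brought to the shared pair, and the second word is run backwards.
  twoTransitive : ∀ {x y u v : Fin N} → x ≢ y → u ≢ v →
                  ∃ λ w → length w ≤ 6 * N × E w x ≡ u × E w y ≡ v
  twoTransitive {x} {y} {u} {v} x≢y u≢v with toShared₂ x≢y | toShared₂ u≢v
  ... | w , lw , wx , wy | w′ , lw′ , w′u , w′v = w ++ invert w′ , length≤ , moves x u (trans wx (sym w′u)) , moves y v (trans wy (sym w′v))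
    where
    moves : ∀ s t → toℕ (E w s) ≡ toℕ (E w′ t) → E (w ++ invert w′) s ≡ t
    moves s t e = trans (eval-++ _ _ w (invert w′) s) (trans (cong (E (invert w′)) (toℕ-injective e)) (E-invert w′ t))
    length≤ : length (w ++ invert w′) ≤ 6 * N
    length≤ = begin
      length (w ++ invert w′)       ≡⟨ length-++ w ⟩
      length w + length (invert w′) ≡⟨ cong (length w +_) (length-invert w′) ⟩
      length w + length w′          ≤⟨ +-mono-≤ lw lw′ ⟩
      3 * N + 3 * N                 ≡⟨ *-distribʳ-+ N 3 3 ⟨
      6 * N                         ∎
      where open ≤-Reasoning

-- Even permutations from a single three-cycle

-- The three-cycles are written in labels from `Fin m` and placed by `e`, so that identities among
-- them can be decided on the small set of labels.
cycleProduct : {m n : ℕ} → (Fin m → Fin n) → List (Fin m × Fin m × Fin m) → Fin n → Fin n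
cycleProduct e []                = id
cycleProduct e ((i , j , k) ∷ l) = threeCycle (e i) (e j) (e k) ∘ cycleProduct e l

cycleProduct-image : {m n : ℕ} (e : Fin m → Fin n) → Inj e → ∀ l x →
                     cycleProduct e l (e x) ≡ e (cycleProduct id l x)
cycleProduct-image e inj []                x = refl
cycleProduct-image e inj ((i , j , k) ∷ l) x = trans
  (cong (threeCycle (e i) (e j) (e k)) (cycleProduct-image e inj l x))
  (sym (doubleTransposition-conj e inj i j j k (cycleProduct id l x)))

cycleProduct-outside : {m n : ℕ} (e : Fin m → Fin n) → ∀ l {x} → (∀ j → x ≢ e j) → cycleProduct e l x ≡ x
cycleProduct-outside e []                x∉e = refl
cycleProduct-outside e ((i , j , k) ∷ l) x∉e = trans
  (cong (threeCycle (e i) (e j) (e k)) (cycleProduct-outside e l x∉e))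
  (trans (cong (transpose (e i) (e j)) (transpose-other (x∉e j) (x∉e k))) (transpose-other (x∉e i) (x∉e j)))

-- On the image of `e` the products act as they do on labels; off the image both are the identity.
cycleProduct-transfer : {m n : ℕ} (e : Fin m → Fin n) → Inj e → ∀ l l′ →
                        cycleProduct id l ≗ cycleProduct id l′ → cycleProduct e l ≗ cycleProduct e l′
cycleProduct-transfer e inj l l′ eq x with any? (λ j → x ≟F e j)
... | yes (j , refl) = trans (cycleProduct-image e inj l j) (trans (cong e (eq j)) (sym (cycleProduct-image e inj l′ j)))
... | no x∉e = trans (cycleProduct-outside e l outside) (sym (cycleProduct-outside e l′ outside))
  where
  outside : ∀ j → x ≢ e j
  outside j x≡ej = x∉e (j , x≡ej)

permutation-injective : {n : ℕ} (π : Permutation′ n) → Inj (π ⟨$⟩ʳ_)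
permutation-injective π {x} {y} e = trans (sym (inverseˡ π)) (trans (cong (π ⟨$⟩ˡ_) e) (inverseˡ π))

length-decompose : {n : ℕ} (π : Permutation′ n) → length (TL.decompose π) ≡ n
length-decompose {zero}  π = refl
length-decompose {suc n} π = cong suc (trans (length-map _ (TL.decompose π′)) (length-decompose π′))
  where π′ = remove 0F (transposeₚ 0F (π ⟨$⟩ˡ 0F) ∘ₚ π)

-- The list has one entry per point, and an entry may be a trivial pair `(i , i)`; `pairUp` skips
-- these.
isPerm⇒transpositions : {n : ℕ} (f : Fin n → Fin n) → IsPerm f →
                        ∃ λ ts → length ts ≡ n × (TL.eval ts ⟨$⟩ʳ_) ≗ f
isPerm⇒transpositions f (inj , surj) = TL.decompose π , length-decompose π , TL.eval-decompose π
  where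
  π : Permutation′ _
  π = permutation f (proj₁ ∘ surj) (λ y → proj₂ (surj y) refl) (λ x → inj (proj₂ (surj (f x)) refl))

module FromThreeCycle (p q : ℕ) {K : ℕ} {u v t : Fin (nV (2 + p) (2 + q))}
  (u≢v : u ≢ v) (u≢t : u ≢ t) (v≢t : v ≢ t)
  (τ : GeneratedIn (2 + p) (2 + q) K (threeCycle u v t)) where

  open Puzzle p q

  L : ℕ
  L = 6 * N + (K + 6 * N)

  -- The given three-cycle is conjugated by a word taking `u`, `v` to `x`, `y`. Nothing is known
  -- about the image `z` of `t` beyond its being a third point; `everyCycle` removes this
  -- uncertainty.
  someCycle : ∀ {x y} → x ≢ y → ∃ λ z → z ≢ x × z ≢ y × G L (threeCycle x y z)
  someCycle x≢y with twoTransitive u≢v x≢y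
  ... | w , lw , refl , refl = E w t , (λ e → u≢t (E-injective w (sym e))) , (λ e → v≢t (E-injective w (sym e))) ,
    G-mono (+-mono-≤ lw (+-monoʳ-≤ K lw)) (G-conj τ w)

  G-cycleProduct : {m : ℕ} (e : Fin m → Fin N) {l : List (Fin m × Fin m × Fin m)} →
                   All (λ (i , j , k) → G L (threeCycle (e i) (e j) (e k))) l →
                   G (length l * L) (cycleProduct e l)
  G-cycleProduct e []       = G-id
  G-cycleProduct e (g ∷ gs) = G-comp g (G-cycleProduct e gs)

  -- The implicit `True` arguments decide the identity on labels and the length bound by
  -- computation. The longest product used below has six factors.
  viaProduct : {m : ℕ} (e : Vec (Fin N) m) → Unique e → ∀ l {i j k} →
               All (λ (i , j , k) → G L (threeCycle (lookup e i) (lookup e j) (lookup e k))) l →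
               {_ : True (all? λ x → cycleProduct id l x ≟F threeCycle i j k x)} {_ : True (length l ≤? 6)} →
               G (6 * L) (threeCycle (lookup e i) (lookup e j) (lookup e k))
  viaProduct e uniq l {i} {j} {k} gs {eq} {l≤6} = G-mono (*-monoˡ-≤ L (toWitness l≤6))
    (G-resp (cycleProduct-transfer (lookup e) (λ {x} {y} → lookup-injective uniq x y) l ((i , j , k) ∷ []) (toWitness eq))
      (G-cycleProduct (lookup e) gs))

  -- For x, y, z, w (and z′) distinct, (x y w) is an explicit product of copies of (x y z) and (x w z′).
  everyCycle : ∀ {x y w} → x ≢ y → x ≢ w → y ≢ w → G (6 * L) (threeCycle x y w)
  everyCycle {x} {y} {w} x≢y x≢w y≢w with someCycle x≢y | someCycle x≢w
  ... | z , z≢x , z≢y , A | z′ , z′≢x , z′≢w , B with z ≟F w | z′ ≟F y | z ≟F z′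
  ... | yes refl | _ | _ = G-mono (m≤n*m L 6) A
  ... | no _ | yes refl | _ =
    -- Here `B` is `(x w y)`, the inverse of the wanted cycle, so its square serves.
    viaProduct (x ∷ y ∷ w ∷ []) ((x≢y ∷ x≢w ∷ []) ∷ (y≢w ∷ []) ∷ [] ∷ [])
      ((0F , 2F , 1F) ∷ (0F , 2F , 1F) ∷ []) {0F} {1F} {2F} (B ∷ B ∷ [])
  ... | no z≢w | no _ | yes refl =
    viaProduct (x ∷ y ∷ z ∷ w ∷ [])
      ((x≢y ∷ ≢-sym z≢x ∷ x≢w ∷ []) ∷ (≢-sym z≢y ∷ y≢w ∷ []) ∷ (z≢w ∷ []) ∷ [] ∷ [])
      ((0F , 3F , 2F) ∷ (0F , 3F , 2F) ∷ (0F , 1F , 2F) ∷ []) {0F} {1F} {3F} (B ∷ B ∷ A ∷ [])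
  ... | no z≢w | no z′≢y | no z≢z′ =
    viaProduct (x ∷ y ∷ z ∷ w ∷ z′ ∷ [])
      ((x≢y ∷ ≢-sym z≢x ∷ x≢w ∷ ≢-sym z′≢x ∷ []) ∷ (≢-sym z≢y ∷ y≢w ∷ ≢-sym z′≢y ∷ []) ∷
       (z≢w ∷ z≢z′ ∷ []) ∷ (≢-sym z′≢w ∷ []) ∷ [] ∷ [])
      ((0F , 1F , 2F) ∷ (0F , 3F , 4F) ∷ (0F , 1F , 2F) ∷ (0F , 1F , 2F) ∷ (0F , 3F , 4F) ∷ (0F , 3F , 4F) ∷ [])
      {0F} {1F} {3F} (A ∷ B ∷ A ∷ A ∷ B ∷ B ∷ [])

  -- Two transpositions sharing a point form a three-cycle, or cancel if they are equal.
  chain : ∀ {i j k} → i ≢ j → j ≢ k → G (6 * L) (doubleTransposition i j j k)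
  chain {i} {j} {k} i≢j j≢k with i ≟F k
  ... | yes refl = G-resp (λ x → sym (trans (cong (transpose i j) (transpose-comm j i x)) (transpose-involutive i j x))) G-id
  ... | no i≢k   = everyCycle i≢j i≢k j≢k

  M : ℕ
  M = 6 * L + 6 * L

  -- Inserting `(j k)` twice gives `(i j)(j k)` times `(j k)(k l)`, a product of two chains.
  everyDouble : ∀ {i j k l} → i ≢ j → k ≢ l → G M (doubleTransposition i j k l)
  everyDouble {i} {j} {k} {l} i≢j k≢l with j ≟F k
  ... | yes refl = G-mono (m≤m+n (6 * L) (6 * L)) (chain i≢j k≢l)
  ... | no j≢k   = G-resp (λ x → cong (transpose i j) (transpose-involutive j k (transpose k l x)))
                     (G-comp (chain i≢j j≢k) (chain j≢k k≢l))

  -- The invariant for pairing off a list of transpositions: in the odd case one nontrivial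
  -- transposition is held back until a partner arrives. The sign records which case occurs, so for
  -- an even permutation nothing is left over.
  UpToTransposition : ℕ → (Fin N → Fin N) → Set
  UpToTransposition m f =
      (sign f ≡ 0ℙ × G (m * M) f)
    ⊎ (sign f ≡ 1ℙ × ∃ λ g → ∃₂ λ i j → i ≢ j × G (m * M) g × f ≗ (g ∘ transpose i j))

  pairUp : ∀ ts → UpToTransposition (length ts) (TL.eval ts ⟨$⟩ʳ_)
  pairUp [] = inj₁ (sign-id {N} , G-id)
  pairUp ((i , j) ∷ ts) with i ≟F j | pairUp ts
  ... | yes refl | inj₁ (s , g) = inj₁ (trans (sign-cong same) s , G-mono (m≤n+m _ M) (G-resp (sym ∘ same) g))
    where
    same : (TL.eval ((i , i) ∷ ts) ⟨$⟩ʳ_) ≗ (TL.eval ts ⟨$⟩ʳ_)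
    same x = cong (TL.eval ts ⟨$⟩ʳ_) (transpose-self i x)
  ... | yes refl | inj₂ (s , h , k , l , k≢l , g , e) =
    inj₂ (trans (sign-cong same) s , h , k , l , k≢l , G-mono (m≤n+m _ M) g , λ x → trans (same x) (e x))
    where
    same : (TL.eval ((i , i) ∷ ts) ⟨$⟩ʳ_) ≗ (TL.eval ts ⟨$⟩ʳ_)
    same x = cong (TL.eval ts ⟨$⟩ʳ_) (transpose-self i x)
  ... | no i≢j | inj₁ (s , g) =
    inj₂ (trans (sign-transpose (TL.eval ts ⟨$⟩ʳ_) (permutation-injective (TL.eval ts)) i≢j) (cong _⁻¹ s) ,
          (TL.eval ts ⟨$⟩ʳ_) , i , j , i≢j , G-mono (m≤n+m _ M) g , λ _ → refl)
  ... | no i≢j | inj₂ (s , h , k , l , k≢l , g , e) =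
    inj₁ (trans (sign-transpose (TL.eval ts ⟨$⟩ʳ_) (permutation-injective (TL.eval ts)) i≢j) (cong _⁻¹ s) ,
          G-mono (≤-reflexive (+-comm _ M)) (G-resp (λ x → sym (e (transpose i j x))) (G-comp g (everyDouble k≢l i≢j))))

  G-even : ∀ f → IsPerm f → sign f ≡ 0ℙ → G (N * M) f
  G-even f perm s with isPerm⇒transpositions f perm
  ... | ts , l , e with pairUp ts
  ...   | inj₁ (_ , g) = G-mono (≤-reflexive (cong (_* M) l)) (G-resp e g)
  ...   | inj₂ (odd , _) with trans (sym odd) (trans (sign-cong e) s)
  ...     | ()

-- A three-cycle of bounded length

doubleTransposition-unique : {n : ℕ} (f : Fin n → Fin n) {x y z u : Fin n} →
  x ≢ z → x ≢ u → y ≢ z → y ≢ u → f x ≡ y → f y ≡ x → f z ≡ u → f u ≡ z →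
  (∀ i → i ≢ x → i ≢ y → i ≢ z → i ≢ u → f i ≡ i) → f ≗ doubleTransposition x y z u
doubleTransposition-unique f {x} {y} {z} {u} x≢z x≢u y≢z y≢u fx fy fz fu fixed i = go (i ≟F x) (i ≟F y) (i ≟F z) (i ≟F u)
  where
  go : Dec (i ≡ x) → Dec (i ≡ y) → Dec (i ≡ z) → Dec (i ≡ u) → f i ≡ doubleTransposition x y z u i
  go (yes refl) _ _ _ = trans fx (sym (trans (cong (transpose x y) (transpose-other x≢z x≢u)) (transpose-fst x y)))
  go (no _) (yes refl) _ _ = trans fy (sym (trans (cong (transpose x y) (transpose-other y≢z y≢u)) (transpose-snd x y)))
  go (no _) (no _) (yes refl) _ = trans fz (sym (trans (cong (transpose x y) (transpose-fst z u)) (transpose-other (≢-sym x≢u) (≢-sym y≢u))))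
  go (no _) (no _) (no _) (yes refl) = trans fu (sym (trans (cong (transpose x y) (transpose-snd z u)) (transpose-other (≢-sym x≢z) (≢-sym y≢z))))
  go (no i≢x) (no i≢y) (no i≢z) (no i≢u) = trans (fixed i i≢x i≢y i≢z i≢u)
    (sym (trans (cong (transpose x y) (transpose-other i≢z i≢u)) (transpose-other i≢x i≢y)))

threeCycle-unique : {n : ℕ} (f : Fin n → Fin n) {x y z : Fin n} →
  x ≢ y → x ≢ z → f x ≡ y → f y ≡ z → f z ≡ x →
  (∀ i → i ≢ x → i ≢ y → i ≢ z → f i ≡ i) → f ≗ threeCycle x y z
threeCycle-unique f {x} {y} {z} x≢y x≢z fx fy fz fixed i = go (i ≟F x) (i ≟F y) (i ≟F z)
  where
  go : Dec (i ≡ x) → Dec (i ≡ y) → Dec (i ≡ z) → f i ≡ threeCycle x y z i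
  go (yes refl) _ _ = trans fx (sym (trans (cong (transpose x y) (transpose-other x≢y x≢z)) (transpose-fst x y)))
  go (no _) (yes refl) (yes refl) = ⊥-elim (x≢y (trans (sym fz) fy))
  go (no _) (yes refl) (no y≢z) = trans fy (sym (trans (cong (transpose x y) (transpose-fst y z)) (transpose-other (≢-sym x≢z) (≢-sym y≢z))))
  go (no _) (no _) (yes refl) = trans fz (sym (trans (cong (transpose x y) (transpose-snd y z)) (transpose-snd x y)))
  go (no i≢x) (no i≢y) (no i≢z) = trans (fixed i i≢x i≢y i≢z)
    (sym (trans (cong (transpose x y) (transpose-other i≢y i≢z)) (transpose-other i≢x i≢y)))

transpose-unique : {n : ℕ} (f : Fin n → Fin n) {x y : Fin n} → f x ≡ y → f y ≡ x →
  (∀ i → i ≢ x → i ≢ y → f i ≡ i) → f ≗ transpose x y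
transpose-unique f {x} {y} fx fy fixed i = go (i ≟F x) (i ≟F y)
  where
  go : Dec (i ≡ x) → Dec (i ≡ y) → f i ≡ transpose x y i
  go (yes refl) _ = trans fx (sym (transpose-fst x y))
  go (no _) (yes refl) = trans fy (sym (transpose-snd x y))
  go (no i≢x) (no i≢y) = trans (fixed i i≢x i≢y) (sym (transpose-other i≢x i≢y))

-- The common factor `(z u)` is disjoint from `(x w)`, hence commutes past it and cancels;
-- `(x y)(x w)` remains.
doubleTransposition-sharing : {n : ℕ} {x y z u w : Fin n} → x ≢ z → x ≢ u → w ≢ z → w ≢ u →
  (doubleTransposition x y z u ∘ doubleTransposition x w z u) ≗ threeCycle y x w
doubleTransposition-sharing {x = x} {y} {z} {u} {w} x≢z x≢u w≢z w≢u i = begin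
  transpose x y (σ (transpose x w (σ i)))          ≡⟨ cong (transpose x y) (transpose-conj σ (transpose-injective z u) x w (σ i)) ⟩
  transpose x y (transpose (σ x) (σ w) (σ (σ i)))  ≡⟨ cong₂ (λ s t → transpose x y (transpose s t (σ (σ i)))) (transpose-other x≢z x≢u) (transpose-other w≢z w≢u) ⟩
  transpose x y (transpose x w (σ (σ i)))          ≡⟨ cong (transpose x y ∘ transpose x w) (transpose-involutive z u i) ⟩
  transpose x y (transpose x w i)                  ≡⟨ transpose-comm x y (transpose x w i) ⟩
  transpose y x (transpose x w i)                  ∎
  where
  open ≡-Reasoning
  σ = transpose z u

module ShortCycle (p q : ℕ) where

  open Puzzle p q

  -- An equation wrapped in a data type, so that unification can read off the letter and both
  -- positions. A `Path` then displays the journey of one point letter by letter.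
  data Step (g : Gen) (i j : ℕ) : Set where
    step : genℕ g i ≡ j → Step g i j

  infixr 5 _▸_
  data Path : List Gen → ℕ → ℕ → Set where
    end : ∀ {i} → Path [] i i
    _▸_ : ∀ {g w i j k} → Step g i j → Path w j k → Path (g ∷ w) i k

  evalℕ-path : ∀ {w i j} → Path w i j → evalℕ w i ≡ j
  evalℕ-path end = refl
  evalℕ-path {g ∷ w} (step e ▸ path) = trans (cong (evalℕ w) e) (evalℕ-path path)

  αstep : ∀ {i} → i ≤ p → Step α i (suc i)
  αstep i≤p = step (cycUp-step z≤n (s≤s i≤p))

  αtop : Step α (suc p) 0
  αtop = step (cycUp-top {0} {suc p} z≤n)

  αout : ∀ {i} → suc p < i → Step α i i
  αout sp<i = step (cycUp-above {0} sp<i)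

  α⁻¹step : ∀ {i} → i ≤ p → Step α⁻¹ (suc i) i
  α⁻¹step i≤p = step (cycDown-step z≤n (s≤s i≤p))

  α⁻¹0 : Step α⁻¹ 0 (suc p)
  α⁻¹0 = step (cycDown-bottom 0 (suc p))

  α⁻¹out : ∀ {i} → suc p < i → Step α⁻¹ i i
  α⁻¹out sp<i = step (cycDown-above z≤n sp<i)

  βstep : ∀ {i} → p ≤ i → i < p + suc q → Step β i (suc i)
  βstep p≤i i<last = step (cycUp-step p≤i i<last)

  βtop : ∀ {i} → i ≡ p + suc q → Step β i p
  βtop i≡last = step (trans (cong (genℕ β) i≡last) βlast)

  βout : ∀ {i} → i < p → Step β i i
  βout i<p = step (cycUp-below i<p)

  β⁻¹step : ∀ {i} → p ≤ i → i < p + suc q → Step β⁻¹ (suc i) i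
  β⁻¹step p≤i i<last = step (cycDown-step p≤i i<last)

  β⁻¹p : Step β⁻¹ p (p + suc q)
  β⁻¹p = step (cycDown-bottom p (p + suc q))

  β⁻¹out : ∀ {i} → i < p → Step β⁻¹ i i
  β⁻¹out i<p = step (cycDown-below i<p)

  point : ∀ i → i ≤ p + suc q → Fin N
  point i i≤ = fromℕ< (<N i≤)

  toℕ-point : ∀ {i} (i≤ : i ≤ p + suc q) → toℕ (point i i≤) ≡ i
  toℕ-point i≤ = toℕ-fromℕ< (<N i≤)

  E-point : ∀ {i j} {x y : Fin N} w → toℕ x ≡ i → toℕ y ≡ j → Path w i j → E w x ≡ y
  E-point w x≡i y≡j path = toℕ-injective
    (trans (toℕ-E w _) (trans (cong (evalℕ w) x≡i) (trans (evalℕ-path path) (sym y≡j))))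

  apart : ∀ {i j} {x y : Fin N} → toℕ x ≡ i → toℕ y ≡ j → i ≢ j → x ≢ y
  apart x≡i y≡j i≢j e = i≢j (trans (sym x≡i) (trans (cong toℕ e) y≡j))

  elsewhere : ∀ {i} {x y : Fin N} → toℕ y ≡ i → x ≢ y → toℕ x ≢ i
  elsewhere y≡i x≢y e = x≢y (toℕ-injective (trans e (sym y≡i)))

  E-fixes : ∀ w (x : Fin N) → Path w (toℕ x) (toℕ x) → E w x ≡ x
  E-fixes w x path = toℕ-injective (trans (toℕ-E w x) (evalℕ-path path))

  -- A conjugate is identified by tracing four positions along `w`.
  G-conj-to : ∀ {K} {x y z u x′ y′ z′ u′ : Fin N} {i j k l i′ j′ k′ l′} →
              toℕ x ≡ i → toℕ y ≡ j → toℕ z ≡ k → toℕ u ≡ l →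
              toℕ x′ ≡ i′ → toℕ y′ ≡ j′ → toℕ z′ ≡ k′ → toℕ u′ ≡ l′ →
              G K (doubleTransposition x y z u) → ∀ w →
              Path w i i′ → Path w j j′ → Path w k k′ → Path w l l′ →
              G (length w + (K + length w)) (doubleTransposition x′ y′ z′ u′)
  G-conj-to x≡ y≡ z≡ u≡ x′≡ y′≡ z′≡ u′≡ D w i→i′ j→j′ k→k′ l→l′
    with E-point w x≡ x′≡ i→i′ | E-point w y≡ y′≡ j→j′ | E-point w z≡ z′≡ k→k′ | E-point w u≡ u′≡ l→l′
  ... | refl | refl | refl | refl = G-conj D w

  G-doubleTransposition : ∀ {x y z u : Fin N} {i j k l} →
              toℕ x ≡ i → toℕ y ≡ j → toℕ z ≡ k → toℕ u ≡ l →
              i ≢ k → i ≢ l → j ≢ k → j ≢ l → ∀ w →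
              Path w i j → Path w j i → Path w k l → Path w l k →
              (∀ m → m ≤ p + suc q → m ≢ i → m ≢ j → m ≢ k → m ≢ l → Path w m m) →
              G (length w) (doubleTransposition x y z u)
  G-doubleTransposition x≡ y≡ z≡ u≡ i≢k i≢l j≢k j≢l w i→j j→i k→l l→k other =
    w , ≤-refl , doubleTransposition-unique (E w)
      (apart x≡ z≡ i≢k) (apart x≡ u≡ i≢l) (apart y≡ z≡ j≢k) (apart y≡ u≡ j≢l)
      (E-point w x≡ y≡ i→j) (E-point w y≡ x≡ j→i) (E-point w z≡ u≡ k→l) (E-point w u≡ z≡ l→k)
      λ m m≢x m≢y m≢z m≢u → E-fixes w m (other (toℕ m) (<N⇒≤ (toℕ<n m))
        (elsewhere x≡ m≢x) (elsewhere y≡ m≢y) (elsewhere z≡ m≢z) (elsewhere u≡ m≢u))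

  -- The bound 18 comes from the longest case: the four-letter commutator conjugated by words of two
  -- and of three letters costs 8 and 10 shifts.
  HasThreeCycle : Set
  HasThreeCycle = ∃ λ x → ∃₂ λ y z → x ≢ y × x ≢ z × y ≢ z × G 18 (threeCycle x y z)

  -- Conjugating `(x y)` by `g` gives `(y z)`, and the product of the two is a three-cycle. The
  -- transposition is padded with a trivial one so that `G-conj-to` applies.
  fromTransposition : ∀ {x y z : Fin N} {i j k} → toℕ x ≡ i → toℕ y ≡ j → toℕ z ≡ k →
                      i ≢ j → i ≢ k → j ≢ k → G 1 (transpose x y) →
                      ∀ g → Path (g ∷ []) i j → Path (g ∷ []) j k → HasThreeCycle
  fromTransposition {x} {y} {z} x≡ y≡ z≡ i≢j i≢k j≢k D g i→j j→k =
    x , y , z , apart x≡ y≡ i≢j , apart x≡ z≡ i≢k , apart y≡ z≡ j≢k ,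
    G-mono (toWitness {a? = 4 ≤? 18} _)
      (G-comp D (G-resp (λ i → cong (transpose y z) (transpose-self y i))
        (G-conj-to {K = 1} x≡ y≡ x≡ x≡ y≡ z≡ y≡ y≡ (G-resp (λ i → cong (transpose x y) (sym (transpose-self x i))) D)
          (g ∷ []) i→j j→k i→j i→j)))

  s≤ : p ≤ p + suc q
  s≤ = p≤last

  t≤ : suc p ≤ p + suc q
  t≤ = sp≤last

  s t : Fin N
  s = point p s≤
  t = point (suc p) t≤

  s≡ : toℕ s ≡ p
  s≡ = toℕ-point s≤

  t≡ : toℕ t ≡ suc p
  t≡ = toℕ-point t≤

  s≢t : s ≢ t
  s≢t = apart s≡ t≡ (<⇒≢ ≤-refl)

  u≤ : 1 ≤ q → suc (suc p) ≤ p + suc q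
  u≤ 1≤q = subst (suc (suc p) ≤_) (sym (+-suc p q)) (s≤s (subst (_≤ p + q) (+-comm p 1) (+-monoʳ-≤ p 1≤q)))

  A₁ : Fin N
  A₁ = point 0 z≤n

  A₁≡ : toℕ A₁ ≡ 0
  A₁≡ = toℕ-point z≤n

  -- Here `α` is the transposition `(s t)`, and `β` carries `s` to `t` and `t` to `B₁`.
  case-a=2 : p ≡ 0 → 1 ≤ q → HasThreeCycle
  case-a=2 p≡0 1≤q = fromTransposition s≡ t≡ B₁≡ (<⇒≢ ≤-refl) (<⇒≢ (n≤1+n _)) (<⇒≢ ≤-refl)
    (α ∷ [] , ≤-refl , transpose-unique (E (α ∷ [])) (E-point (α ∷ []) s≡ t≡ (αstep ≤-refl ▸ end))
      (E-point (α ∷ []) t≡ s≡ (subst (Path (α ∷ []) (suc p)) (sym p≡0) (αtop ▸ end)))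
      (λ i i≢s i≢t → E-fixes (α ∷ []) i (αout (out p≡0 (toℕ i) (elsewhere s≡ i≢s) (elsewhere t≡ i≢t)) ▸ end)))
    β (βstep ≤-refl t≤ ▸ end) (βstep (n≤1+n p) (u≤ 1≤q) ▸ end)
    where
    B₁ = point (suc (suc p)) (u≤ 1≤q)
    B₁≡ : toℕ B₁ ≡ suc (suc p)
    B₁≡ = toℕ-point (u≤ 1≤q)
    out : ∀ {r} → r ≡ 0 → ∀ i → i ≢ r → i ≢ suc r → suc r < i
    out refl 0 i≢0 _ = ⊥-elim (i≢0 refl)
    out refl 1 _ i≢1 = ⊥-elim (i≢1 refl)
    out refl (suc (suc _)) _ _ = s≤s (s≤s z≤n)

  case-b=2 : q ≡ 0 → 1 ≤ p → HasThreeCycle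
  case-b=2 q≡0 1≤p = fromTransposition s≡ t≡ A₁≡ (<⇒≢ ≤-refl) (≢-sym (<⇒≢ 1≤p)) (λ ())
    (β ∷ [] , ≤-refl , transpose-unique (E (β ∷ [])) (E-point (β ∷ []) s≡ t≡ (βstep ≤-refl t≤ ▸ end))
      (E-point (β ∷ []) t≡ s≡ (βtop (sym last≡) ▸ end))
      (λ i i≢s i≢t → E-fixes (β ∷ []) i (βout (out (toℕ i) (elsewhere s≡ i≢s) (elsewhere t≡ i≢t) (<N⇒≤ (toℕ<n i))) ▸ end)))
    α (αstep ≤-refl ▸ end) (αtop ▸ end)
    where
    last≡ : p + suc q ≡ suc p
    last≡ = trans (cong (λ r → p + suc r) q≡0) (+-comm p 1)
    out : ∀ i → i ≢ p → i ≢ suc p → i ≤ p + suc q → i < p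
    out i i≢p i≢sp i≤ = ≤∧≢⇒< (≤-pred (≤∧≢⇒< (subst (i ≤_) last≡ i≤) i≢sp)) i≢p

  case-a=3 : p ≡ 1 → HasThreeCycle
  case-a=3 p≡1 = s , t , A₁ , s≢t , s≢A₁ , apart t≡ A₁≡ (λ ()) ,
    (α ∷ [] , s≤s z≤n , threeCycle-unique (E (α ∷ [])) s≢t s≢A₁
      (E-point (α ∷ []) s≡ t≡ (αstep ≤-refl ▸ end)) (E-point (α ∷ []) t≡ A₁≡ (αtop ▸ end))
      (E-point (α ∷ []) A₁≡ s≡ (subst (Path (α ∷ []) 0) (sym p≡1) (αstep z≤n ▸ end)))
      λ i i≢s i≢t i≢A → E-fixes (α ∷ []) i
        (αout (out p≡1 (toℕ i) (elsewhere s≡ i≢s) (elsewhere t≡ i≢t) (elsewhere A₁≡ i≢A)) ▸ end))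
    where
    s≢A₁ : s ≢ A₁
    s≢A₁ = apart s≡ A₁≡ λ p≡0 → 0≢1+n (trans (sym p≡0) p≡1)
    out : ∀ {r} → r ≡ 1 → ∀ i → i ≢ r → i ≢ suc r → i ≢ 0 → suc r < i
    out refl 0 _ _ i≢0 = ⊥-elim (i≢0 refl)
    out refl 1 i≢1 _ _ = ⊥-elim (i≢1 refl)
    out refl 2 _ i≢2 _ = ⊥-elim (i≢2 refl)
    out refl (suc (suc (suc _))) _ _ _ = s≤s (s≤s (s≤s z≤n))

  module _ (1≤q : 1 ≤ q) where

    B₁ : Fin N
    B₁ = point (suc (suc p)) (u≤ 1≤q)

    B₁≡ : toℕ B₁ ≡ suc (suc p)
    B₁≡ = toℕ-point (u≤ 1≤q)

    sp<last : suc p < p + suc q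
    sp<last = u≤ 1≤q

  case-b=3 : q ≡ 1 → HasThreeCycle
  case-b=3 q≡1 = s , t , u , s≢t , s≢u , apart t≡ u≡ (<⇒≢ ≤-refl) ,
    (β ∷ [] , s≤s z≤n , threeCycle-unique (E (β ∷ [])) s≢t s≢u
      (E-point (β ∷ []) s≡ t≡ (βstep ≤-refl t≤ ▸ end))
      (E-point (β ∷ []) t≡ u≡ (βstep (n≤1+n p) (sp<last 1≤q) ▸ end))
      (E-point (β ∷ []) u≡ s≡ (βtop (sym last≡) ▸ end))
      λ i i≢s i≢t i≢u → E-fixes (β ∷ []) i
        (βout (out (toℕ i) (elsewhere s≡ i≢s) (elsewhere t≡ i≢t) (elsewhere u≡ i≢u) (<N⇒≤ (toℕ<n i))) ▸ end))
    where
    1≤q : 1 ≤ q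
    1≤q = ≤-reflexive (sym q≡1)
    u = B₁ 1≤q
    u≡ : toℕ u ≡ suc (suc p)
    u≡ = B₁≡ 1≤q
    s≢u : s ≢ u
    s≢u = apart s≡ u≡ (<⇒≢ (n≤1+n _))
    last≡ : p + suc q ≡ suc (suc p)
    last≡ = trans (cong (λ r → p + suc r) q≡1) (+-comm p 2)
    out : ∀ i → i ≢ p → i ≢ suc p → i ≢ suc (suc p) → i ≤ p + suc q → i < p
    out i i≢p i≢sp i≢ssp i≤ =
      ≤∧≢⇒< (≤-pred (≤∧≢⇒< (≤-pred (≤∧≢⇒< (subst (i ≤_) last≡ i≤) i≢ssp)) i≢sp)) i≢p

  -- The commutator, and three-cycles from a cycle of length at least five

  module LongCycles (1≤p : 1 ≤ p) (1≤q : 1 ≤ q) where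

    b₁ : Fin N
    b₁ = B₁ 1≤q

    b₁≡ : toℕ b₁ ≡ suc (suc p)
    b₁≡ = B₁≡ 1≤q

    t<last : suc p < p + suc q
    t<last = sp<last 1≤q

    commutator : List Gen
    commutator = α⁻¹ ∷ β⁻¹ ∷ α ∷ β ∷ []

    -- A point below `p` is lowered by one and stays off `β`, so `α` undoes `α⁻¹`. A point beyond
    -- `suc (suc p)` is lowered by one and stays off `α`, so `β` undoes `β⁻¹`.
    commutator-other : ∀ i → i ≤ p + suc q → i ≢ 0 → i ≢ suc (suc p) → i ≢ p → i ≢ suc p → Path commutator i i
    commutator-other zero _ i≢0 _ _ _ = ⊥-elim (i≢0 refl)
    commutator-other (suc i) i≤ _ i≢ssp i≢p i≢sp with <-cmp (suc i) p
    ... | tri< i<p _ _ = α⁻¹step (<⇒≤ (<⇒≤ i<p)) ▸ β⁻¹out (<⇒≤ i<p) ▸ αstep (<⇒≤ (<⇒≤ i<p)) ▸ βout i<p ▸ end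
    ... | tri≈ _ i≡p _ = ⊥-elim (i≢p i≡p)
    ... | tri> _ _ p<i = α⁻¹out sp<si ▸ β⁻¹step p≤i i≤ ▸ αout sp<i ▸ βstep p≤i i≤ ▸ end
      where
      sp<si : suc p < suc i
      sp<si = ≤∧≢⇒< p<i (≢-sym i≢sp)
      sp<i : suc p < i
      sp<i = ≤-pred (≤∧≢⇒< sp<si (≢-sym i≢ssp))
      p≤i : p ≤ i
      p≤i = <⇒≤ (<⇒≤ sp<i)

    -- The position of `s` is a separate variable so that it can be matched as a successor, which
    -- the first step by `α⁻¹` requires.
    commutator-s : ∀ r → r ≡ p → 1 ≤ r → Path commutator r (suc p)
    commutator-s (suc r) refl _ = α⁻¹step (n≤1+n r) ▸ β⁻¹out ≤-refl ▸ αstep (n≤1+n r) ▸ βstep ≤-refl t≤ ▸ end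

    G-commutator : G 4 (doubleTransposition A₁ b₁ s t)
    G-commutator = G-doubleTransposition A₁≡ b₁≡ s≡ t≡
      (<⇒≢ 1≤p) (λ ()) (≢-sym (<⇒≢ (n≤1+n _))) (≢-sym (<⇒≢ ≤-refl)) commutator
      (α⁻¹0 ▸ β⁻¹step ≤-refl t≤ ▸ αstep ≤-refl ▸ βstep (n≤1+n p) t<last ▸ end)
      (α⁻¹out ≤-refl ▸ β⁻¹step (n≤1+n p) t<last ▸ αtop ▸ βout 1≤p ▸ end)
      (commutator-s p refl 1≤p)
      (α⁻¹step ≤-refl ▸ β⁻¹p ▸ αout t<last ▸ βtop refl ▸ end)
      commutator-other

    -- The commutator conjugated by w and by w′ is (A₃ b₁)(A₁ A₂) and (A₃ t)(A₁ A₂); the common factor cancels.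
    case-a≥5 : 3 ≤ p → HasThreeCycle
    case-a≥5 3≤p = b₁ , A₃ , t ,
      apart b₁≡ A₃≡ (≢-sym (<⇒≢ (m≤n⇒m≤1+n (m≤n⇒m≤1+n 3≤p)))) , apart b₁≡ t≡ (≢-sym (<⇒≢ ≤-refl)) ,
      A₃≢t ,
      G-resp (doubleTransposition-sharing (apart A₃≡ A₁≡ λ ()) (apart A₃≡ A₂≡ λ ())
               (apart t≡ A₁≡ λ ()) (apart t≡ A₂≡ (≢-sym (<⇒≢ (s≤s 1≤p)))))
        (G-comp
          (G-conj-to A₁≡ b₁≡ s≡ t≡ A₃≡ b₁≡ A₁≡ A₂≡ G-commutator w
            (αstep z≤n ▸ αstep 1≤p ▸ end)
            (αout ≤-refl ▸ αout ≤-refl ▸ end)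
            (αstep ≤-refl ▸ αtop ▸ end)
            (αtop ▸ αstep z≤n ▸ end))
          -- The hypothesis `3 ≤ p` puts `A₃`, at position 2, below `s`. So the final `β⁻¹` fixes
          -- `A₁`, `A₂` and `A₃`, and only `b₁` moves, to `t`.
          (G-conj-to A₁≡ b₁≡ s≡ t≡ A₃≡ t≡ A₁≡ A₂≡ G-commutator w′
            (αstep z≤n ▸ αstep 1≤p ▸ β⁻¹out 3≤p ▸ end)
            (αout ≤-refl ▸ αout ≤-refl ▸ β⁻¹step (n≤1+n p) t<last ▸ end)
            (αstep ≤-refl ▸ αtop ▸ β⁻¹out 1≤p ▸ end)
            (αtop ▸ αstep z≤n ▸ β⁻¹out (≤-trans (n≤1+n 2) 3≤p) ▸ end)))
      where
      w w′ : List Gen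
      w = α ∷ α ∷ []
      w′ = α ∷ α ∷ β⁻¹ ∷ []
      1≤ : 1 ≤ p + suc q
      1≤ = ≤-trans 1≤p s≤
      2≤ : 2 ≤ p + suc q
      2≤ = ≤-trans (≤-trans (n≤1+n 2) 3≤p) s≤
      A₂ A₃ : Fin N
      A₂ = point 1 1≤
      A₃ = point 2 2≤
      A₂≡ : toℕ A₂ ≡ 1
      A₂≡ = toℕ-point 1≤
      A₃≡ : toℕ A₃ ≡ 2
      A₃≡ = toℕ-point 2≤
      A₃≢t : A₃ ≢ t
      A₃≢t = apart A₃≡ t≡ (<⇒≢ (m≤n⇒m≤1+n 3≤p))

    -- The mirror image of `case-a≥5`: conjugating by `β` twice, without and with a final `α⁻¹`,
    -- gives `(B₃ A₁)(b₁ B₂)` and `(B₃ t)(b₁ B₂)`.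
    case-b≥5 : 3 ≤ q → HasThreeCycle
    case-b≥5 3≤q = A₁ , B₃ , t , apart A₁≡ B₃≡ (λ ()) , apart A₁≡ t≡ (λ ()) , apart B₃≡ t≡ (≢-sym (<⇒≢ (s≤s (s≤s p≤2+p)))) ,
      G-resp (doubleTransposition-sharing (apart B₃≡ b₁≡ (≢-sym (<⇒≢ (n≤1+n _)))) (apart B₃≡ B₂≡ (≢-sym (<⇒≢ ≤-refl)))
               (apart t≡ b₁≡ (<⇒≢ ≤-refl)) (apart t≡ B₂≡ (<⇒≢ (n≤1+n _))))
        (G-comp
          (G-conj-to b₁≡ A₁≡ s≡ t≡ B₃≡ A₁≡ b₁≡ B₂≡ reversed w
            (βstep p≤2+p 3≤ ▸ βstep (m≤n⇒m≤1+n p≤2+p) 4≤ ▸ end)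
            (βout 1≤p ▸ βout 1≤p ▸ end)
            (βstep ≤-refl t≤ ▸ βstep (n≤1+n p) t<last ▸ end)
            (βstep (n≤1+n p) t<last ▸ βstep p≤2+p 3≤ ▸ end))
          (G-conj-to b₁≡ A₁≡ s≡ t≡ B₃≡ t≡ b₁≡ B₂≡ reversed w′
            (βstep p≤2+p 3≤ ▸ βstep (m≤n⇒m≤1+n p≤2+p) 4≤ ▸ α⁻¹out (s≤s (s≤s p≤2+p)) ▸ end)
            (βout 1≤p ▸ βout 1≤p ▸ α⁻¹0 ▸ end)
            (βstep ≤-refl t≤ ▸ βstep (n≤1+n p) t<last ▸ α⁻¹out ≤-refl ▸ end)
            (βstep (n≤1+n p) t<last ▸ βstep p≤2+p 3≤ ▸ α⁻¹out (n≤1+n _) ▸ end)))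
      where
      w w′ : List Gen
      w = β ∷ β ∷ []
      w′ = β ∷ β ∷ α⁻¹ ∷ []
      p≤2+p : p ≤ 2 + p
      p≤2+p = m≤n+m p 2
      4≤ : 4 + p ≤ p + suc q
      4≤ = subst (_≤ p + suc q) (+-comm p 4) (+-monoʳ-≤ p (s≤s 3≤q))
      3≤ : 3 + p ≤ p + suc q
      3≤ = <⇒≤ 4≤
      B₂ B₃ : Fin N
      B₂ = point (3 + p) 3≤
      B₃ = point (4 + p) 4≤
      B₂≡ : toℕ B₂ ≡ 3 + p
      B₂≡ = toℕ-point 3≤
      B₃≡ : toℕ B₃ ≡ 4 + p
      B₃≡ = toℕ-point 4≤
      reversed : G 4 (doubleTransposition b₁ A₁ s t)
      reversed = G-resp (λ i → transpose-comm A₁ b₁ (transpose s t i)) G-commutator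

-- A cycle of length two or three is used directly. Otherwise both lengths are at least four, and
-- excluding the pair of fours leaves a cycle of length at least five.
threeCycleExists : ∀ p q → ¬ (p ≡ 0 × q ≡ 0) → ¬ (p ≡ 2 × q ≡ 2) → ShortCycle.HasThreeCycle p q
threeCycleExists 0 0 ne _ = ⊥-elim (ne (refl , refl))
threeCycleExists 0 (suc q) _ _ = ShortCycle.case-a=2 0 (suc q) refl (s≤s z≤n)
threeCycleExists (suc p) 0 _ _ = ShortCycle.case-b=2 (suc p) 0 refl (s≤s z≤n)
threeCycleExists 1 q@(suc _) _ _ = ShortCycle.case-a=3 1 q refl
threeCycleExists p@(suc (suc _)) 1 _ _ = ShortCycle.case-b=3 p 1 refl
threeCycleExists 2 2 _ ne = ⊥-elim (ne (refl , refl))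
threeCycleExists 2 q@(suc (suc (suc _))) _ _ =
  ShortCycle.LongCycles.case-b≥5 2 q (s≤s z≤n) (s≤s z≤n) (s≤s (s≤s (s≤s z≤n)))
threeCycleExists p@(suc (suc (suc _))) q@(suc (suc _)) _ _ =
  ShortCycle.LongCycles.case-a≥5 p q (s≤s z≤n) (s≤s z≤n) (s≤s (s≤s (s≤s z≤n)))

-- Signs of the two cycles

liftFin-cycUp-injective : {n lo hi : ℕ} → lo ≤ hi → hi < n → Inj (liftFin {n} (cycUp lo hi))
liftFin-cycUp-injective {n} {lo} {hi} lo≤hi hi<n {x} {y} e = toℕ-injective (begin
  toℕ x                                           ≡⟨ cycDown-cycUp lo≤hi (toℕ x) ⟨
  cycDown lo hi (cycUp lo hi (toℕ x))             ≡⟨ cong (cycDown lo hi) (toℕ-liftFin (cycUp lo hi) x (cycUp-< lo≤hi hi<n (toℕ<n x))) ⟨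
  cycDown lo hi (toℕ (liftFin (cycUp lo hi) x))   ≡⟨ cong (cycDown lo hi ∘ toℕ) e ⟩
  cycDown lo hi (toℕ (liftFin (cycUp lo hi) y))   ≡⟨ cong (cycDown lo hi) (toℕ-liftFin (cycUp lo hi) y (cycUp-< lo≤hi hi<n (toℕ<n y))) ⟩
  cycDown lo hi (cycUp lo hi (toℕ y))             ≡⟨ cycDown-cycUp lo≤hi (toℕ y) ⟩
  toℕ y ∎)
  where open ≡-Reasoning

liftFin-toℕ : {n : ℕ} (f : ℕ → ℕ) (i : Fin n) {j : Fin n} → f (toℕ i) ≡ toℕ j → liftFin f i ≡ j
liftFin-toℕ {n} f i {j} e = toℕ-injective (trans (toℕ-liftFin f i (subst (_< n) (sym e) (toℕ<n j))) e)

cycUp-trivial : ∀ lo i → cycUp lo lo i ≡ i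
cycUp-trivial lo i with cyclePosition lo lo i
... | under i<lo = cycUp-below i<lo
... | inside lo≤i i<lo = ⊥-elim (<⇒≱ i<lo lo≤i)
... | top = cycUp-top ≤-refl
... | over lo<i = cycUp-above {lo} lo<i

-- Lengthening a cycle by one point multiplies it by one adjacent transposition: `hi` is sent to the
-- new point, which the shorter cycle fixes, and the new point to `hi` and on to `lo`.
cycUp-suc : {n lo hi : ℕ} → lo ≤ hi → (hi<n : hi < n) (shi<n : suc hi < n) →
            liftFin {n} (cycUp lo (suc hi)) ≗ (liftFin (cycUp lo hi) ∘ transpose (fromℕ< hi<n) (fromℕ< shi<n))
cycUp-suc {n} {lo} {hi} lo≤hi hi<n shi<n i = liftFin-toℕ (cycUp lo (suc hi)) i
  (trans (go (i ≟F H) (i ≟F H′)) (sym (toℕ-liftFin _ _ (cycUp-< lo≤hi hi<n (toℕ<n _)))))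
  where
  H = fromℕ< hi<n
  H′ = fromℕ< shi<n
  toℕ-H : toℕ H ≡ hi
  toℕ-H = toℕ-fromℕ< hi<n
  toℕ-H′ : toℕ H′ ≡ suc hi
  toℕ-H′ = toℕ-fromℕ< shi<n
  outside : ∀ j → j ≢ hi → j ≢ suc hi → cycUp lo (suc hi) j ≡ cycUp lo hi j
  outside j j≢hi j≢shi with cyclePosition lo hi j
  ... | under j<lo = trans (cycUp-below j<lo) (sym (cycUp-below j<lo))
  ... | inside lo≤j j<hi = trans (cycUp-step lo≤j (m≤n⇒m≤1+n j<hi)) (sym (cycUp-step lo≤j j<hi))
  ... | top = ⊥-elim (j≢hi refl)
  ... | over hi<j = trans (cycUp-above {lo} (≤∧≢⇒< hi<j (≢-sym j≢shi))) (sym (cycUp-above {lo} hi<j))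
  go : Dec (i ≡ H) → Dec (i ≡ H′) → cycUp lo (suc hi) (toℕ i) ≡ cycUp lo hi (toℕ (transpose H H′ i))
  go (yes refl) _ = begin
    cycUp lo (suc hi) (toℕ H)                  ≡⟨ cong (cycUp lo (suc hi)) toℕ-H ⟩
    cycUp lo (suc hi) hi                       ≡⟨ cycUp-step lo≤hi ≤-refl ⟩
    suc hi                                     ≡⟨ cycUp-above {lo} ≤-refl ⟨
    cycUp lo hi (suc hi)                       ≡⟨ cong (cycUp lo hi) toℕ-H′ ⟨
    cycUp lo hi (toℕ H′)                       ≡⟨ cong (cycUp lo hi ∘ toℕ) (transpose-fst H H′) ⟨
    cycUp lo hi (toℕ (transpose H H′ H))       ∎
    where open ≡-Reasoning
  go (no _) (yes refl) = begin
    cycUp lo (suc hi) (toℕ H′)                 ≡⟨ cong (cycUp lo (suc hi)) toℕ-H′ ⟩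
    cycUp lo (suc hi) (suc hi)                 ≡⟨ cycUp-top (m≤n⇒m≤1+n lo≤hi) ⟩
    lo                                         ≡⟨ cycUp-top lo≤hi ⟨
    cycUp lo hi hi                             ≡⟨ cong (cycUp lo hi) toℕ-H ⟨
    cycUp lo hi (toℕ H)                        ≡⟨ cong (cycUp lo hi ∘ toℕ) (transpose-snd H H′) ⟨
    cycUp lo hi (toℕ (transpose H H′ H′))      ∎
    where open ≡-Reasoning
  go (no i≢H) (no i≢H′) = trans
    (outside (toℕ i) (λ e → i≢H (toℕ-injective (trans e (sym toℕ-H)))) (λ e → i≢H′ (toℕ-injective (trans e (sym toℕ-H′)))))
    (cong (cycUp lo hi ∘ toℕ) (sym (transpose-other i≢H i≢H′)))

⁻¹-+ℙ : ∀ x y → (x +ℙ y) ⁻¹ ≡ x ⁻¹ +ℙ y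
⁻¹-+ℙ 0ℙ y = refl
⁻¹-+ℙ 1ℙ y = ⁻¹-involutive y

+ℙ-self : ∀ x y → x +ℙ (x +ℙ y) ≡ y
+ℙ-self 0ℙ y = refl
+ℙ-self 1ℙ y = ⁻¹-involutive y

-- A cycle on `suc d` points is a product of `d` transpositions. The arbitrary `f` in front lets
-- signs of words be computed letter by letter.
sign-cycUp : {n : ℕ} (d lo : ℕ) → d + lo < n → (f : Fin n → Fin n) → Inj f →
             sign (f ∘ liftFin (cycUp lo (d + lo))) ≡ parity d +ℙ sign f
sign-cycUp zero lo lo<n f inj = sign-cong (λ i → cong f (liftFin-toℕ (cycUp lo lo) i (cycUp-trivial lo (toℕ i))))
sign-cycUp (suc d) lo hi<n f inj = begin
  sign (f ∘ liftFin (cycUp lo (suc d + lo)))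
    ≡⟨ sign-cong (cong f ∘ cycUp-suc (m≤n+m lo d) hi′<n hi<n) ⟩
  sign (f ∘ liftFin (cycUp lo (d + lo)) ∘ transpose (fromℕ< hi′<n) (fromℕ< hi<n))
    ≡⟨ sign-transpose _ (liftFin-cycUp-injective (m≤n+m lo d) hi′<n ∘ inj) distinct ⟩
  sign (f ∘ liftFin (cycUp lo (d + lo))) ⁻¹
    ≡⟨ cong _⁻¹ (sign-cycUp d lo hi′<n f inj) ⟩
  (parity d +ℙ sign f) ⁻¹
    ≡⟨ ⁻¹-+ℙ (parity d) (sign f) ⟩
  parity d ⁻¹ +ℙ sign f
    ≡⟨ cong (_+ℙ sign f) (⁻¹-parity d) ⟨
  parity (suc d) +ℙ sign f ∎
  where
  open ≡-Reasoning
  hi′<n = <⇒≤ hi<n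
  distinct : fromℕ< hi′<n ≢ fromℕ< hi<n
  distinct e = <⇒≢ ≤-refl (trans (sym (toℕ-fromℕ< hi′<n)) (trans (cong toℕ e) (toℕ-fromℕ< hi<n)))

module Parities (p q : ℕ) where

  open Puzzle p q

  genParity : Gen → Parity
  genParity α   = parity (suc p)
  genParity α⁻¹ = parity (suc p)
  genParity β   = parity (suc q)
  genParity β⁻¹ = parity (suc q)

  g[_] : Gen → Fin N → Fin N
  g[ g ] = gen (2 + p) (2 + q) g

  sign-α : ∀ f → Inj f → sign (f ∘ g[ α ]) ≡ parity (suc p) +ℙ sign f
  sign-α f inj = trans (sign-cong λ i → cong (λ h → f (liftFin (cycUp 0 h) i)) (sym (+-identityʳ (suc p))))
    (sign-cycUp (suc p) 0 (subst (_< N) (sym (+-identityʳ (suc p))) (<N sp≤last)) f inj)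

  sign-β : ∀ f → Inj f → sign (f ∘ g[ β ]) ≡ parity (suc q) +ℙ sign f
  sign-β f inj = trans (sign-cong λ i → cong (λ h → f (liftFin (cycUp p h) i)) (trans (cong (_∸ 1) N≡) (+-comm p (suc q))))
    (sign-cycUp (suc q) p (subst (_< N) (+-comm p (suc q)) last<N) f inj)

  -- Appending `g` after its inverse restores `f`, and adding a parity twice changes nothing.
  sign-inverse : ∀ g → (∀ f → Inj f → sign (f ∘ g[ g ]) ≡ genParity g +ℙ sign f) →
                 ∀ f → Inj f → sign (f ∘ g[ inverse g ]) ≡ genParity g +ℙ sign f
  sign-inverse g sg f inj = begin
    sign f′                                     ≡⟨ +ℙ-self (genParity g) (sign f′) ⟨
    genParity g +ℙ (genParity g +ℙ sign f′)     ≡⟨ cong (genParity g +ℙ_) (sg f′ (E-injective (inverse g ∷ []) ∘ inj)) ⟨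
    genParity g +ℙ sign (f′ ∘ g[ g ])           ≡⟨ cong (genParity g +ℙ_) (sign-cong λ i → cong f (E-invert (g ∷ []) i)) ⟩
    genParity g +ℙ sign f                       ∎
    where
    open ≡-Reasoning
    f′ = f ∘ g[ inverse g ]

  sign-gen : ∀ g f → Inj f → sign (f ∘ g[ g ]) ≡ genParity g +ℙ sign f
  sign-gen α   = sign-α
  sign-gen α⁻¹ = sign-inverse α sign-α
  sign-gen β   = sign-β
  sign-gen β⁻¹ = sign-inverse β sign-β

  evenWords : parity (suc p) ≡ 0ℙ → parity (suc q) ≡ 0ℙ → ∀ w → sign (E w) ≡ 0ℙ
  evenWords ep eq []      = sign-id {N}
  evenWords ep eq (g ∷ w) = trans (sign-gen g (E w) (E-injective w)) (trans (cong (_+ℙ sign (E w)) (even g)) (evenWords ep eq w))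
    where
    even : ∀ g → genParity g ≡ 0ℙ
    even α   = ep
    even α⁻¹ = ep
    even β   = eq
    even β⁻¹ = eq

  -- An odd `f` becomes even when composed with the odd generator `g`; undoing `g` costs one shift.
  G-odd : ∀ {K} g → genParity g ≡ 1ℙ → (∀ f → IsPerm f → sign f ≡ 0ℙ → G K f) →
          ∀ f → IsPerm f → G (suc K) f
  G-odd {K} g odd Ge f perm with sign f in s
  ... | 0ℙ = G-mono (n≤1+n K) (Ge f perm s)
  ... | 1ℙ = G-mono (≤-reflexive (+-comm K 1))
    (G-resp (λ i → cong f (E-invertʳ (g ∷ []) i))
      (G-comp (Ge (f ∘ g[ g ]) (∘-perm f perm) (trans (sign-gen g f (proj₁ perm)) (cong₂ _+ℙ_ odd s)))
        (inverse g ∷ [] , ≤-refl , λ _ → refl)))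
    where
    ∘-perm : ∀ f → IsPerm f → IsPerm (f ∘ g[ g ])
    ∘-perm f (inj , surj) = (λ e → E-injective (g ∷ []) (inj e)) ,
      λ y → g[ inverse g ] (proj₁ (surj y)) , λ { refl → trans (cong f (E-invertʳ (g ∷ []) _)) (proj₂ (surj y) refl) }

-- The (4,4)-puzzle

-- A 1-factorisation of K₆ preserved by both cycles: the edge xy has colour (colour x y),
-- and (mate i x) is the other end of the edge of colour i at x. Diagonal entries of colour are junk.
colour : Fin 6 → Fin 6 → Fin 5
colour x y = lookup (lookup table x) y
  where
  table : Vec (Vec (Fin 5) 6) 6
  table = (0F ∷ 0F ∷ 1F ∷ 2F ∷ 3F ∷ 4F ∷ [])
        ∷ (0F ∷ 0F ∷ 4F ∷ 1F ∷ 2F ∷ 3F ∷ [])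
        ∷ (1F ∷ 4F ∷ 0F ∷ 3F ∷ 0F ∷ 2F ∷ [])
        ∷ (2F ∷ 1F ∷ 3F ∷ 0F ∷ 4F ∷ 0F ∷ [])
        ∷ (3F ∷ 2F ∷ 0F ∷ 4F ∷ 0F ∷ 1F ∷ [])
        ∷ (4F ∷ 3F ∷ 2F ∷ 0F ∷ 1F ∷ 0F ∷ [])
        ∷ []

mate : Fin 5 → Fin 6 → Fin 6
mate i x = lookup (lookup table i) x
  where
  table : Vec (Vec (Fin 6) 6) 5
  table = (1F ∷ 0F ∷ 4F ∷ 5F ∷ 2F ∷ 3F ∷ [])
        ∷ (2F ∷ 3F ∷ 0F ∷ 1F ∷ 5F ∷ 4F ∷ [])
        ∷ (3F ∷ 4F ∷ 5F ∷ 0F ∷ 1F ∷ 2F ∷ [])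
        ∷ (4F ∷ 5F ∷ 3F ∷ 2F ∷ 0F ∷ 1F ∷ [])
        ∷ (5F ∷ 2F ∷ 1F ∷ 4F ∷ 3F ∷ 0F ∷ [])
        ∷ []

-- Colour `i` is that of the edge from 0 to `suc i`, so the image of this one edge determines the
-- image of the colour.
onColours : (Fin 6 → Fin 6) → Fin 5 → Fin 5
onColours g i = colour (g 0F) (g (suc i))

mate-colour : ∀ x y → x ≡ y ⊎ mate (colour x y) x ≡ y
mate-colour = toWitness {a? = all? λ x → all? λ y → (x ≟F y) ⊎-dec (mate (colour x y) x ≟F y)} _

onColours-id : onColours id ≗ id
onColours-id = toWitness {a? = all? λ i → onColours id i ≟F i} _

RespectsColours : (Fin 6 → Fin 6) → Set
RespectsColours g = ∀ x y → x ≡ y ⊎ colour (g x) (g y) ≡ onColours g (colour x y)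

respectsColours? : ∀ g → Dec (RespectsColours g)
respectsColours? g = all? λ x → all? λ y → (x ≟F y) ⊎-dec (colour (g x) (g y) ≟F onColours g (colour x y))

gen-respects : ∀ g → RespectsColours (gen 4 4 g)
gen-respects α   = toWitness {a? = respectsColours? (gen 4 4 α)} _
gen-respects α⁻¹ = toWitness {a? = respectsColours? (gen 4 4 α⁻¹)} _
gen-respects β   = toWitness {a? = respectsColours? (gen 4 4 β)} _
gen-respects β⁻¹ = toWitness {a? = respectsColours? (gen 4 4 β⁻¹)} _

module P₄₄ = Puzzle 2 2

onColours-∘ : ∀ g h → RespectsColours g → Inj h → onColours (g ∘ h) ≗ (onColours g ∘ onColours h)
onColours-∘ g h rg ih i with rg (h 0F) (h (suc i))
... | inj₂ e = e
... | inj₁ e with ih e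
...   | ()

respects-∘ : ∀ g h → RespectsColours g → RespectsColours h → Inj h → RespectsColours (g ∘ h)
respects-∘ g h rg rh ih x y with rh x y | rg (h x) (h y)
... | inj₁ e | _ = inj₁ e
... | _ | inj₁ e = inj₁ (ih e)
... | inj₂ eh | inj₂ eg = inj₂ (trans eg (trans (cong (onColours g) eh) (sym (onColours-∘ g h rg ih (colour x y)))))

respects-cong : ∀ g h → g ≗ h → RespectsColours g → RespectsColours h
respects-cong g h e rg x y with rg x y
... | inj₁ x≡y = inj₁ x≡y
... | inj₂ eq = inj₂ (trans (sym (cong₂ colour (e x) (e y))) (trans eq (cong₂ colour (e 0F) (e _))))

eval-respects : ∀ w → RespectsColours (eval 4 4 w)
eval-respects []      x y = inj₂ (sym (onColours-id (colour x y)))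
eval-respects (g ∷ w) = respects-∘ (eval 4 4 w) (gen 4 4 g) (eval-respects w) (gen-respects g) (P₄₄.E-injective (g ∷ []))

config-respects : ∀ g → InConfig 4 4 g → RespectsColours g
config-respects g (w , e) = respects-cong (eval 4 4 w) g e (eval-respects w)

config-injective : ∀ {g} → InConfig 4 4 g → Inj g
config-injective c = proj₁ (P₄₄.inConfig⇒perm c)

-- If every colour is fixed, the image of 0 determines all other images through `mate`. For each
-- nonzero image, `obstruction` exhibits an edge whose colour would then change, so 0 is fixed and
-- everything else with it.
trivialOnColours : ∀ w → onColours (eval 4 4 w) ≗ id → eval 4 4 w ≗ id
trivialOnColours w triv = λ { zero → k0≡0 ; (suc i) → trans (ksuc i) (trans (cong (mate i) k0≡0) (mate-0 i)) }
  where
  k : Fin 6 → Fin 6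
  k = eval 4 4 w
  preserves : ∀ x y → x ≡ y ⊎ colour (k x) (k y) ≡ colour x y
  preserves x y with eval-respects w x y
  ... | inj₁ e = inj₁ e
  ... | inj₂ e = inj₂ (trans e (triv (colour x y)))
  ksuc : ∀ i → k (suc i) ≡ mate i (k 0F)
  ksuc i with mate-colour (k 0F) (k (suc i))
  ... | inj₂ e = trans (sym e) (cong (λ c → mate c (k 0F)) (triv i))
  ... | inj₁ e with P₄₄.E-injective w e
  ...   | ()
  mate-0 : ∀ i → mate i 0F ≡ suc i
  mate-0 = toWitness {a? = all? λ i → mate i 0F ≟F suc i} _
  obstruction : ∀ r → r ≡ 0F ⊎ ∃₂ λ i j → i ≢ j × colour (mate i r) (mate j r) ≢ colour (suc i) (suc j)
  obstruction = toWitness {a? = all? λ r → (r ≟F 0F) ⊎-dec any? λ i → any? λ j →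
    ¬? (i ≟F j) ×-dec ¬? (colour (mate i r) (mate j r) ≟F colour (suc i) (suc j))} _
  k0≡0 : k 0F ≡ 0F
  k0≡0 with obstruction (k 0F)
  ... | inj₁ e = e
  ... | inj₂ (i , j , i≢j , bad) with preserves (suc i) (suc j)
  ...   | inj₁ e = ⊥-elim (i≢j (sucF-injective e))
  ...   | inj₂ e = ⊥-elim (bad (trans (sym (cong₂ colour (ksuc i) (ksuc j))) e))

onColours-invert : ∀ w → (onColours (eval 4 4 (invert w)) ∘ onColours (eval 4 4 w)) ≗ id
onColours-invert w i = begin
  onColours (eval 4 4 (invert w)) (onColours (eval 4 4 w) i)
    ≡⟨ onColours-∘ (eval 4 4 (invert w)) (eval 4 4 w) (eval-respects (invert w)) (P₄₄.E-injective w) i ⟨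
  onColours (eval 4 4 (invert w) ∘ eval 4 4 w) i
    ≡⟨ cong₂ colour (P₄₄.E-invert w 0F) (P₄₄.E-invert w (suc i)) ⟩
  onColours id i
    ≡⟨ onColours-id i ⟩
  i ∎
  where open ≡-Reasoning

onColours-invertʳ : ∀ w → (onColours (eval 4 4 w) ∘ onColours (eval 4 4 (invert w))) ≗ id
onColours-invertʳ w i = begin
  onColours (eval 4 4 w) (onColours (eval 4 4 (invert w)) i)
    ≡⟨ onColours-∘ (eval 4 4 w) (eval 4 4 (invert w)) (eval-respects w) (P₄₄.E-injective (invert w)) i ⟨
  onColours (eval 4 4 w ∘ eval 4 4 (invert w)) i
    ≡⟨ cong₂ colour (P₄₄.E-invertʳ w 0F) (P₄₄.E-invertʳ w (suc i)) ⟩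
  onColours id i
    ≡⟨ onColours-id i ⟩
  i ∎
  where open ≡-Reasoning

onColours-cong : ∀ g h → g ≗ h → onColours g ≗ onColours h
onColours-cong g h e i = cong₂ colour (e 0F) (e (suc i))

onColours-perm : ∀ g → InConfig 4 4 g → IsPerm (onColours g)
onColours-perm g (w , e) =
  (λ {x} {y} eq → trans (sym (onColours-invert w x)) (trans (cong (onColours (eval 4 4 (invert w)))
    (trans (onColours-cong (eval 4 4 w) g e x) (trans eq (sym (onColours-cong (eval 4 4 w) g e y))))) (onColours-invert w y))) ,
  (λ y → onColours (eval 4 4 (invert w)) y , λ { refl → trans (sym (onColours-cong (eval 4 4 w) g e _)) (onColours-invertʳ w y) })

onColours-faithful : ∀ v w → onColours (eval 4 4 v) ≗ onColours (eval 4 4 w) → eval 4 4 v ≗ eval 4 4 w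
onColours-faithful v w eq i = begin
  eval 4 4 v i                                        ≡⟨ P₄₄.E-invertʳ w _ ⟨
  eval 4 4 w (eval 4 4 (invert w) (eval 4 4 v i))     ≡⟨ cong (eval 4 4 w) (eval-++ 4 4 v (invert w) i) ⟨
  eval 4 4 w (eval 4 4 (v ++ invert w) i)             ≡⟨ cong (eval 4 4 w) (trivialOnColours (v ++ invert w) trivial i) ⟩
  eval 4 4 w i                                        ∎
  where
  open ≡-Reasoning
  trivial : onColours (eval 4 4 (v ++ invert w)) ≗ id
  trivial j = begin
    onColours (eval 4 4 (v ++ invert w)) j                      ≡⟨ onColours-cong (eval 4 4 (v ++ invert w)) (eval 4 4 (invert w) ∘ eval 4 4 v) (eval-++ 4 4 v (invert w)) j ⟩
    onColours (eval 4 4 (invert w) ∘ eval 4 4 v) j              ≡⟨ onColours-∘ (eval 4 4 (invert w)) (eval 4 4 v) (eval-respects (invert w)) (P₄₄.E-injective v) j ⟩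
    onColours (eval 4 4 (invert w)) (onColours (eval 4 4 v) j)  ≡⟨ cong (onColours (eval 4 4 (invert w))) (eq j) ⟩
    onColours (eval 4 4 (invert w)) (onColours (eval 4 4 w) j)  ≡⟨ onColours-invert w j ⟩
    j ∎

-- Explicit words inducing the transpositions of two colours, verified by evaluation below. All have
-- at most five letters except `w₂₄`, which has seven.
transpositionWord : Fin 5 → Fin 5 → List Gen
transpositionWord i j = lookup (lookup table i) j
  where
  w₀₁ = α ∷ β⁻¹ ∷ α ∷ β⁻¹ ∷ α ∷ []
  w₀₂ = α⁻¹ ∷ β ∷ α⁻¹ ∷ β ∷ β ∷ []
  w₀₃ = β ∷ α ∷ β⁻¹ ∷ α ∷ β ∷ []
  w₀₄ = α ∷ β⁻¹ ∷ α ∷ β ∷ β ∷ []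
  w₁₂ = α ∷ α ∷ β⁻¹ ∷ α ∷ β⁻¹ ∷ []
  w₁₃ = α ∷ β ∷ α⁻¹ ∷ β ∷ α ∷ []
  w₁₄ = α ∷ α ∷ β ∷ α⁻¹ ∷ β ∷ []
  w₂₃ = α ∷ β ∷ β ∷ α ∷ β⁻¹ ∷ []
  w₂₄ = α ∷ α ∷ β ∷ α ∷ β⁻¹ ∷ α ∷ β ∷ []
  w₃₄ = α ∷ β⁻¹ ∷ α ∷ α ∷ β⁻¹ ∷ []
  table : Vec (Vec (List Gen) 5) 5
  table = ([]  ∷ w₀₁ ∷ w₀₂ ∷ w₀₃ ∷ w₀₄ ∷ [])
        ∷ (w₀₁ ∷ []  ∷ w₁₂ ∷ w₁₃ ∷ w₁₄ ∷ [])
        ∷ (w₀₂ ∷ w₁₂ ∷ []  ∷ w₂₃ ∷ w₂₄ ∷ [])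
        ∷ (w₀₃ ∷ w₁₃ ∷ w₂₃ ∷ []  ∷ w₃₄ ∷ [])
        ∷ (w₀₄ ∷ w₁₄ ∷ w₂₄ ∷ w₃₄ ∷ []  ∷ [])
        ∷ []

transpositionWord-correct : ∀ i j → onColours (eval 4 4 (transpositionWord i j)) ≗ transpose i j
transpositionWord-correct = toWitness {a? = all? λ i → all? λ j → all? λ k →
  onColours (eval 4 4 (transpositionWord i j)) k ≟F transpose i j k} _

transpositionWord-length : ∀ i j → length (transpositionWord i j) ≤ 7
transpositionWord-length = toWitness {a? = all? λ i → all? λ j → length (transpositionWord i j) ≤? 7} _

onColours-++ : ∀ v w {σ τ} → onColours (eval 4 4 v) ≗ τ → onColours (eval 4 4 w) ≗ σ →
               onColours (eval 4 4 (v ++ w)) ≗ (σ ∘ τ)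
onColours-++ v w {σ} {τ} ev ew k = begin
  onColours (eval 4 4 (v ++ w)) k                     ≡⟨ onColours-cong (eval 4 4 (v ++ w)) (eval 4 4 w ∘ eval 4 4 v) (eval-++ 4 4 v w) k ⟩
  onColours (eval 4 4 w ∘ eval 4 4 v) k               ≡⟨ onColours-∘ (eval 4 4 w) (eval 4 4 v) (eval-respects w) (P₄₄.E-injective v) k ⟩
  onColours (eval 4 4 w) (onColours (eval 4 4 v) k)   ≡⟨ ew (onColours (eval 4 4 v) k) ⟩
  σ (onColours (eval 4 4 v) k)                        ≡⟨ cong σ (ev k) ⟩
  σ (τ k) ∎
  where open ≡-Reasoning

transpositionsOnColours : ∀ ts → ∃ λ w → length w ≤ length ts * 7 × onColours (eval 4 4 w) ≗ (TL.eval ts ⟨$⟩ʳ_)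
transpositionsOnColours [] = [] , z≤n , onColours-id
transpositionsOnColours ((i , j) ∷ ts) with transpositionsOnColours ts
... | w , l , e = transpositionWord i j ++ w ,
  ≤-trans (≤-reflexive (length-++ (transpositionWord i j))) (+-mono-≤ (transpositionWord-length i j) l) ,
  onColours-++ (transpositionWord i j) w {TL.eval ts ⟨$⟩ʳ_} {transpose i j} (transpositionWord-correct i j) e

-- Five transpositions of colours at seven letters each give 35.
onColours-surjective : ∀ σ → IsPerm σ → ∃ λ w → length w ≤ 35 × onColours (eval 4 4 w) ≗ σ
onColours-surjective σ perm = go (isPerm⇒transpositions σ perm)
  where
  go : (∃ λ ts → length ts ≡ 5 × (TL.eval ts ⟨$⟩ʳ_) ≗ σ) → ∃ λ w → length w ≤ 35 × onColours (eval 4 4 w) ≗ σ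
  go (ts , l , e) with transpositionsOnColours ts
  ... | w , lw , ew = w , ≤-trans lw (≤-reflexive (cong (_* 7) l)) , λ i → trans (ew i) (e i)

onColours-reflects : ∀ g h → InConfig 4 4 g → InConfig 4 4 h → onColours g ≗ onColours h → g ≗ h
onColours-reflects g h (v , ev) (w , ew) e i = trans (sym (ev i)) (trans
  (onColours-faithful v w (λ j → trans (onColours-cong (eval 4 4 v) g ev j)
    (trans (e j) (sym (onColours-cong (eval 4 4 w) h ew j)))) i) (ew i))

onColours-onto : ∀ σ → IsPerm σ → Σ (Fin 6 → Fin 6) λ g → InConfig 4 4 g × onColours g ≗ σ
onColours-onto σ perm = go (onColours-surjective σ perm)
  where
  go : (∃ λ w → length w ≤ 35 × onColours (eval 4 4 w) ≗ σ) → Σ (Fin 6 → Fin 6) λ g → InConfig 4 4 g × onColours g ≗ σ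
  go (w , _ , e) = eval 4 4 w , (w , λ _ → refl) , e

isoSym₅ : IsoSym (InConfig 4 4) 5
isoSym₅ = onColours , onColours-perm , (λ g h _ _ → onColours-cong g h) ,
  (λ g h cg ch → onColours-∘ g h (config-respects g cg) (config-injective ch)) ,
  onColours-reflects , onColours-onto

-- A short word with the same action on colours as `f` equals `f` by faithfulness.
generatedIn₄₄ : ∀ f → InConfig 4 4 f → GeneratedIn 4 4 35 f
generatedIn₄₄ f c = go (onColours-surjective (onColours f) (onColours-perm f c))
  where
  go : (∃ λ w → length w ≤ 35 × onColours (eval 4 4 w) ≗ onColours f) → GeneratedIn 4 4 35 f
  go (w , l , e) = w , l , onColours-reflects (eval 4 4 w) f (w , λ _ → refl) c e

-- The configuration group and its diameter

-- A cycle of length `2 + n` is a product of `suc n` transpositions, so cycles of odd length are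
-- even permutations.
parity-odd : ∀ n → Odd n → parity (suc n) ≡ 0ℙ
parity-odd n odd = trans (⁻¹-parity n) (cong _⁻¹ (trans (parity-% n) (cong parity odd)))

parity-¬odd : ∀ n → ¬ Odd n → parity (suc n) ≡ 1ℙ
parity-¬odd n ¬odd with %2-cases n
... | inj₁ (_ , even) = trans (⁻¹-parity n) (cong _⁻¹ even)
... | inj₂ (odd , _)  = ⊥-elim (¬odd odd)

odd? : ∀ n → Dec (Odd n)
odd? n = n % 2 ≟ 1

-- Covers two cycles of length two, where there are too few points for a three-cycle and the empty
-- word suffices.
even-Fin2 : (f : Fin 2 → Fin 2) → IsPerm f → sign f ≡ 0ℙ → id ≗ f
even-Fin2 f (inj , _) even = go (f 0F) (f 1F) refl refl
  where
  go : ∀ x y → f 0F ≡ x → f 1F ≡ y → id ≗ f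
  go 0F 1F f0 f1 = λ { 0F → sym f0 ; 1F → sym f1 }
  go 0F 0F f0 f1 with inj (trans f0 (sym f1))
  ... | ()
  go 1F 1F f0 f1 with inj (trans f0 (sym f1))
  ... | ()
  go 1F 0F f0 f1 with trans (sym even) (cong parity (cong₂ (λ x y → below {1} (toℕ x) (λ _ → toℕ y) + 0) f0 f1))
  ... | ()

-- Constants of the quadratic bound

module Bound (p q : ℕ) where

  open Puzzle p q

  2≤N : 2 ≤ N
  2≤N = ≤-trans (s≤s (s≤s z≤n)) (m≤n+m (2 + q) p)

  -- The left side is `N * M` for a three-cycle of 18 shifts. As `N` is at least 2, 18 is at most
  -- `9 * N`, and 12 times 21 is 252.
  fromThreeCycleBound : N * ((6 * (6 * N + (18 + 6 * N))) + (6 * (6 * N + (18 + 6 * N)))) ≤ 252 * N ^ 2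
  fromThreeCycleBound = begin
    N * (6 * (6 * N + (18 + 6 * N)) + 6 * (6 * N + (18 + 6 * N)))
      ≤⟨ *-monoʳ-≤ N (+-mono-≤ bound bound) ⟩
    N * (6 * (6 * N + (9 * N + 6 * N)) + 6 * (6 * N + (9 * N + 6 * N)))
      ≡⟨ collect N ⟩
    252 * N ^ 2 ∎
    where
    open ≤-Reasoning
    bound : 6 * (6 * N + (18 + 6 * N)) ≤ 6 * (6 * N + (9 * N + 6 * N))
    bound = *-monoʳ-≤ 6 (+-monoʳ-≤ (6 * N) (+-monoˡ-≤ (6 * N) (*-monoʳ-≤ 9 2≤N)))
    collect : ∀ x → x * (6 * (6 * x + (9 * x + 6 * x)) + 6 * (6 * x + (9 * x + 6 * x))) ≡ 252 * (x * (x * 1))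
    collect = solve-∀

  1≤N² : 1 ≤ N ^ 2
  1≤N² = ^-monoˡ-≤ 2 (≤-trans (n≤1+n 1) 2≤N)

  35≤ : 35 ≤ 253 * N ^ 2
  35≤ = ≤-trans (toWitness {a? = 35 ≤? 253} _) (*-monoʳ-≤ 253 1≤N²)

  -- Absorbs the one extra shift spent on an odd generator, which raises the final constant to 253.
  step≤ : suc (252 * N ^ 2) ≤ 253 * N ^ 2
  step≤ = +-monoˡ-≤ (252 * N ^ 2) 1≤N²

G-even : ∀ p q → ¬ (p ≡ 2 × q ≡ 2) → ∀ f → IsPerm f → sign f ≡ 0ℙ →
         GeneratedIn (2 + p) (2 + q) (252 * nV (2 + p) (2 + q) ^ 2) f
G-even p q ¬22 f perm even with p ≟ 0 ×-dec q ≟ 0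
... | yes (refl , refl) = [] , z≤n , even-Fin2 f perm even
... | no ¬00 = go (threeCycleExists p q ¬00 ¬22)
  where
  go : ShortCycle.HasThreeCycle p q → GeneratedIn (2 + p) (2 + q) (252 * nV (2 + p) (2 + q) ^ 2) f
  go (x , y , z , x≢y , x≢z , y≢z , τ) = Puzzle.G-mono p q (Bound.fromThreeCycleBound p q)
    (FromThreeCycle.G-even p q x≢y x≢z y≢z τ f perm even)

G-all : ∀ p q → ¬ (p ≡ 2 × q ≡ 2) → ¬ (Odd p × Odd q) → ∀ f → IsPerm f →
        GeneratedIn (2 + p) (2 + q) (253 * nV (2 + p) (2 + q) ^ 2) f
G-all p q ¬22 ¬odd f perm = Puzzle.G-mono p q (Bound.step≤ p q) (go (odd? p) (odd? q))
  where
  go : Dec (Odd p) → Dec (Odd q) → GeneratedIn (2 + p) (2 + q) (suc (252 * nV (2 + p) (2 + q) ^ 2)) f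
  go (yes op) (yes oq) = ⊥-elim (¬odd (op , oq))
  go (no ¬op) _ = Parities.G-odd p q α (parity-¬odd p ¬op) (G-even p q ¬22) f perm
  go _ (no ¬oq) = Parities.G-odd p q β (parity-¬odd q ¬oq) (G-even p q ¬22) f perm

config-even : ∀ p q → Odd p × Odd q → ∀ f → InConfig (2 + p) (2 + q) f → IsPerm f × sign f ≡ 0ℙ
config-even p q (op , oq) f c@(w , e) = Puzzle.inConfig⇒perm p q c ,
  trans (sign-cong (λ i → sym (e i))) (Parities.evenWords p q (parity-odd p op) (parity-odd q oq) w)

generated⇒config : ∀ {a b K f} → GeneratedIn a b K f → InConfig a b f
generated⇒config (w , _ , e) = w , e

odd⇒¬22 : ∀ p q → Odd p × Odd q → ¬ (p ≡ 2 × q ≡ 2)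
odd⇒¬22 _ _ (() , _) (refl , refl)

quadratic : ∀ p q f → InConfig (2 + p) (2 + q) f → GeneratedIn (2 + p) (2 + q) (253 * nV (2 + p) (2 + q) ^ 2) f
quadratic p q f c with p ≟ 2 ×-dec q ≟ 2 | odd? p ×-dec odd? q
... | yes (refl , refl) | _ = Puzzle.G-mono 2 2 (Bound.35≤ 2 2) (generatedIn₄₄ f c)
... | no ¬22 | no ¬odd = G-all p q ¬22 ¬odd f (Puzzle.inConfig⇒perm p q c)
... | no ¬22 | yes odd with config-even p q odd f c
...   | perm , even = Puzzle.G-mono p q (*-monoˡ-≤ (nV (2 + p) (2 + q) ^ 2) (n≤1+n 252)) (G-even p q ¬22 f perm even)

theorem2 : (∀ (a b : ℕ) → 2 ≤ a → 2 ≤ b →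
    ((a ≡ 4 × b ≡ 4) → IsoSym (InConfig a b) 5)
    × ((Odd a × Odd b) → ∀ p → InConfig a b p ⇔ (IsPerm p × IsEven p))
    × (¬ (a ≡ 4 × b ≡ 4) → ¬ (Odd a × Odd b) → ∀ p → InConfig a b p ⇔ IsPerm p))
    × Σ ℕ (λ C → ∀ (a b : ℕ) → 2 ≤ a → 2 ≤ b → ∀ p → InConfig a b p →
    GeneratedIn a b (C * (nV a b ^ 2)) p)
theorem2 = groups , 253 , λ { (suc (suc p)) (suc (suc q)) (s≤s (s≤s z≤n)) (s≤s (s≤s z≤n)) f c → quadratic p q f c }
  where
  groups : ∀ (a b : ℕ) → 2 ≤ a → 2 ≤ b →
    ((a ≡ 4 × b ≡ 4) → IsoSym (InConfig a b) 5)
    × ((Odd a × Odd b) → ∀ p → InConfig a b p ⇔ (IsPerm p × IsEven p))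
    × (¬ (a ≡ 4 × b ≡ 4) → ¬ (Odd a × Odd b) → ∀ p → InConfig a b p ⇔ IsPerm p)
  groups (suc (suc p)) (suc (suc q)) (s≤s (s≤s z≤n)) (s≤s (s≤s z≤n)) =
    (λ { (refl , refl) → isoSym₅ }) ,
    -- Oddness of `2 + p` and of `p` agree by computation, so `odd` is passed on unchanged.
    (λ odd f → mk⇔
      (λ c → let (perm , even) = config-even p q odd f c in perm , sign⇒even f even)
      (λ (perm , even) → generated⇒config (G-even p q (odd⇒¬22 p q odd) f perm (even⇒sign f even)))) ,
    (λ ¬44 ¬odd f → mk⇔ (Puzzle.inConfig⇒perm p q)
      (λ perm → generated⇒config (G-all p q (λ { (refl , refl) → ¬44 (refl , refl) }) ¬odd f perm)))
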